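{- Let $\Phi$ (dimension $d$) and $\Psi$ (dimension $e$) be $\mathbf t$-modules over $K$, let $\delta\in\mathrm{Der}(\Phi,\Psi)$, and let $X$ be the $\mathbf t$-module with $X_a=\begin{bmatrix}\Phi_a&0\\ \delta(a)&\Psi_a\end{bmatrix}$, giving the short exact sequence $0\to\Psi\xrightarrow{i}X\xrightarrow{\pi}\Phi\to0$ with $i=\begin{bmatrix}0\\ I_e\end{bmatrix}$, $\pi=\begin{bmatrix}I_d&0\end{bmatrix}$. Then: (i) for every $\mathbf t$-module $\Xi$ of dimension $r$ and every morphism $g:\Xi\to\Phi$ of $\mathbf t$-modules, the pullback of this sequence along $g$ exists in the category of $\mathbf t$-modules and is the $\mathbf t$-module $Y$ with $Y_a=\begin{bmatrix}\Xi_a&0\\ \delta(a)g&\Psi_a\end{bmatrix}$ (i.e. the extension given by the biderivation $\delta\cdot g$), together with the morphisms $\begin{bmatrix}I_r&0\end{bmatrix}:Y\to\Xi$ and $\begin{bmatrix}g&0\\0&I_e\end{bmatrix}:Y\to X$; (ii) for every $\mathbf t$-module $\Xi$ of dimension $r$ and every morphism $f:\Psi\to\Xi$ of $\mathbf t$-modules, the pushout of this sequence along $f$ exists in the category of $\mathbf t$-modules and is the $\mathbf t$-module $Y$ with $Y_a=\begin{bmatrix}\Phi_a&0\\ f\delta(a)&\Xi_a\end{bmatrix}$ (the extension given by the biderivation $f\cdot\delta$), together with the morphisms $\begin{bmatrix}0\\ I_r\end{bmatrix}:\Xi\to Y$ and $\begin{bmatrix}I_d&0\\0&f\end{bmatrix}:X\to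 Y$.
   Context: $A=\mathbb F_q[t]$, $K$ a field of characteristic $p$ with $\mathbb F_q$-algebra map $\iota:A\to K$, $\theta=\iota(t)$; $K\{\tau\}$ twisted polynomials with $\tau x=x^q\tau$. A $\mathbf t$-module of dimension $d$: $\mathbb F_q$-algebra homomorphism $\Phi:\mathbb F_q[t]\to\mathrm{Mat}_d(K\{\tau\})$ with $\Phi_t=(\theta I+N)+\sum_{i\ge1}M_i\tau^i$, $N$ nilpotent. A morphism from $\Psi$ (dim $e$) to $\Phi$ (dim $d$) is $f\in\mathrm{Mat}_{d\times e}(K\{\tau\})$ with $f\Psi_t=\Phi_tf$; composition is matrix multiplication. $\mathrm{Der}(\Phi,\Psi)$ is the space of $\mathbb F_q$-linear $\delta:\mathbb F_q[t]\to\mathrm{Mat}_{e\times d}(K\{\tau\})$ with $\delta(ab)=\Psi_a\delta(b)+\delta(a)\Phi_b$. -}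

module Defs where

open import Level using (Level; _⊔_) renaming (suc to lsuc)
open import Algebra.Apartness.Bundles using (HeytingField; HeytingCommutativeRing)
open import Algebra.Bundles using (CommutativeRing)
open import Algebra.Bundles.Raw using (RawRing)
open import Algebra.Module.Bundles.Raw using (RawLeftModule)
open import Algebra.Module.Morphism.Structures using (module LeftModuleMorphisms)
open import Algebra.Morphism.Structures using (IsRingHomomorphism)
import Algebra.Definitions.RawSemiring as RawSemiringDefinitions
open import Data.Bool.Base using (if_then_else_)
open import Data.Fin.Base using (Fin)
import Data.Fin.Properties as Fin
open import Data.List.Base as List using (List; []; _∷_)
open import Data.Nat.Base as ℕ using (ℕ; zero; suc)
open import Data.Nat.Divisibility using (_∣_)
open import Data.Nat.Primality using (Prime)
open import Data.Product.Base using (_×_; ∃; ∃-syntax)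
open import Data.Product using (∃!)
open import Data.Vec.Functional as Vector using (Vector)
open import Function.Base using (id)
open import Function.Bundles using (Inverse; _⇔_)
open import Relation.Binary.PropositionalEquality.Core using (_≡_)
open import Relation.Binary.PropositionalEquality.Properties using (setoid)
open import Relation.Nullary.Decidable.Core using (does)

------------------------------------------------------------------------
-- Algebras

record RawAlgebra {r} (R : Set r) (c ℓ : Level) : Set (r ⊔ lsuc (c ⊔ ℓ)) where
  infixr 7 _•_
  field
    rawRing : RawRing c ℓ

  open RawRing rawRing public

  field
    _•_ : R → Carrier → Carrier

  rawLeftModule : RawLeftModule R c ℓ
  rawLeftModule = record
    { _≈ᴹ_ = _≈_ ; _+ᴹ_ = _+_ ; _*ₗ_ = _•_ ; 0ᴹ = 0# ; -ᴹ_ = -_ }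

record IsAlgebraHomomorphism
  {r c₁ ℓ₁ c₂ ℓ₂} {R : Set r} (A : RawAlgebra R c₁ ℓ₁) (B : RawAlgebra R c₂ ℓ₂)
  (f : RawAlgebra.Carrier A → RawAlgebra.Carrier B)
  : Set (r ⊔ c₁ ⊔ ℓ₁ ⊔ ℓ₂) where
  private
    module A = RawAlgebra A
    module B = RawAlgebra B
  field
    isRingHomomorphism : IsRingHomomorphism A.rawRing B.rawRing f
    •-homo             : ∀ c x → f (c A.• x) B.≈ c B.• f x

  open IsRingHomomorphism isRingHomomorphism public

------------------------------------------------------------------------
-- The skew polynomial ring R[τ;σ], in which τ x = σ(x) τ.
--
-- The list a₀ ∷ a₁ ∷ … ∷ aₙ ∷ [] stands for a₀ + a₁ τ + … + aₙ τⁿ.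
-- Trailing zeros are allowed, and equality compares coefficients.

module SkewPolynomial {c ℓ} (R : RawRing c ℓ) (σ : RawRing.Carrier R → RawRing.Carrier R) where

  private module R = RawRing R

  Poly : Set c
  Poly = List R.Carrier

  coeff : Poly → ℕ → R.Carrier
  coeff []      _       = R.0#
  coeff (a ∷ _) zero    = a
  coeff (_ ∷ f) (suc n) = coeff f n

  infix 4 _≈_
  record _≈_ (f g : Poly) : Set ℓ where
    constructor mk≈
    field
      coeff-≈ : ∀ n → coeff f n R.≈ coeff g n

  open _≈_ public

  infixl 6 _+_
  _+_ : Poly → Poly → Poly
  []      + g       = g
  (a ∷ f) + []      = a ∷ f
  (a ∷ f) + (b ∷ g) = (a R.+ b) ∷ (f + g)

  infixr 7 _·_
  _·_ : R.Carrier → Poly → Poly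
  a · f = List.map (a R.*_) f

  τ*_ : Poly → Poly
  τ* f = R.0# ∷ List.map σ f

  -- (a + f τ) g = a g + f (τ g), so the coefficient of τⁿ in f g is
  -- the sum of aᵢ σⁱ(bⱼ) over i + j = n.
  infixl 7 _*_
  _*_ : Poly → Poly → Poly
  []      * g = []
  (a ∷ f) * g = a · g + f * (τ* g)

  constant : R.Carrier → Poly
  constant a = a ∷ []

  τ : Poly
  τ = R.0# ∷ R.1# ∷ []

  rawRing : RawRing c ℓ
  rawRing = record
    { _≈_ = _≈_
    ; _+_ = _+_
    ; _*_ = _*_
    ; -_  = List.map R.-_
    ; 0#  = []
    ; 1#  = constant R.1#
    }

------------------------------------------------------------------------
-- Matrices

module Matrices {c ℓ} (R : RawRing c ℓ) where

  private module R = RawRing R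
  open RawSemiringDefinitions R.rawSemiring using (sum)

  Matrix : ℕ → ℕ → Set c
  Matrix m n = Vector (Vector R.Carrier n) m

  infix 4 _≈_
  _≈_ : ∀ {m n} → Matrix m n → Matrix m n → Set ℓ
  M ≈ N = ∀ i j → M i j R.≈ N i j

  infixl 6 _+_
  _+_ : ∀ {m n} → Matrix m n → Matrix m n → Matrix m n
  (M + N) i j = M i j R.+ N i j

  infix 8 -_
  -_ : ∀ {m n} → Matrix m n → Matrix m n
  (- M) i j = R.- M i j

  infixl 7 _*_
  _*_ : ∀ {l m n} → Matrix l m → Matrix m n → Matrix l n
  (M * N) i k = sum (λ j → M i j R.* N j k)

  0ᴹ : ∀ {m n} → Matrix m n
  0ᴹ _ _ = R.0#

  I : ∀ {n} → Matrix n n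
  I i j = if does (i Fin.≟ j) then R.1# else R.0#

  infixr 7 _·_
  _·_ : ∀ {m n} → R.Carrier → Matrix m n → Matrix m n
  (a · M) i j = a R.* M i j

  -- M ∥ N = [ M N ], and M ⫽ N has the rows of M above those of N.
  infixr 5 _∥_
  _∥_ : ∀ {m n n′} → Matrix m n → Matrix m n′ → Matrix m (n ℕ.+ n′)
  (M ∥ N) i = M i Vector.++ N i

  infixr 4 _⫽_
  _⫽_ : ∀ {m m′ n} → Matrix m n → Matrix m′ n → Matrix (m ℕ.+ m′) n
  M ⫽ N = M Vector.++ N

  rawRing : ℕ → RawRing c ℓ
  rawRing n = record
    { Carrier = Matrix n n
    ; _≈_     = _≈_
    ; _+_     = _+_
    ; _*_     = _*_
    ; -_      = -_
    ; 0#      = 0ᴹ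
    ; 1#      = I
    }

  IsNilpotent : ∀ {n} → Matrix n n → Set ℓ
  IsNilpotent {n} M = ∃[ k ] (M ^ k ≈ 0ᴹ)
    where open RawSemiringDefinitions (RawRing.rawSemiring (rawRing n)) using (_^_)

------------------------------------------------------------------------
-- Base data: the finite field F = 𝔽_q, the ring A = 𝔽_q[t], and the
-- field K with its map ι : A → K.
--
-- A HeytingField is non-trivial (invertible⇒# gives 1# # 0#), and with
-- excluded middle tightness makes _#_ the relation _≉_, so it is then
-- exactly a field.

fieldRing : ∀ {c ℓ a} → HeytingField c ℓ a → CommutativeRing c ℓ
fieldRing F = HeytingCommutativeRing.commutativeRing (HeytingField.heytingCommutativeRing F)

fieldRawRing : ∀ {c ℓ a} → HeytingField c ℓ a → RawRing c ℓ
fieldRawRing F = CommutativeRing.rawRing (fieldRing F)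

HasCharacteristic : ∀ {c ℓ} → RawRing c ℓ → ℕ → Set ℓ
HasCharacteristic R p = ∀ n → (n ×1 ≈ 0#) ⇔ (p ∣ n)
  where
  open RawRing R
  module S = RawSemiringDefinitions rawSemiring
  _×1 : ℕ → Carrier
  n ×1 = n S.× 1#

polynomialAlgebra : ∀ {c ℓ} (R : RawRing c ℓ) → RawAlgebra (RawRing.Carrier R) c ℓ
polynomialAlgebra R = record { rawRing = R[t].rawRing ; _•_ = R[t]._·_ }
  where module R[t] = SkewPolynomial R id

record BaseData (c₁ ℓ₁ a₁ c₂ ℓ₂ a₂ : Level)
  : Set (lsuc (c₁ ⊔ ℓ₁ ⊔ a₁ ⊔ c₂ ⊔ ℓ₂ ⊔ a₂)) where
  field
    p m q    : ℕ
    p-prime  : Prime p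
    q≡pᵐ     : q ≡ p ℕ.^ m

    F        : HeytingField c₁ ℓ₁ a₁
    F-finite : Inverse (setoid (Fin q)) (CommutativeRing.setoid (fieldRing F))

    K        : HeytingField c₂ ℓ₂ a₂
    K-char   : HasCharacteristic (fieldRawRing K) p

  module F = HeytingField F
  module K = HeytingField K

  field
    F→K       : F.Carrier → K.Carrier
    F→K-isHom : IsRingHomomorphism (fieldRawRing F) (fieldRawRing K) F→K

  A-algebra : RawAlgebra F.Carrier c₁ ℓ₁
  A-algebra = polynomialAlgebra (fieldRawRing F)

  K-algebra : RawAlgebra F.Carrier c₂ ℓ₂
  K-algebra = record { rawRing = fieldRawRing K ; _•_ = λ c x → F→K c K.* x }

  module A = RawAlgebra A-algebra

  field
    ι       : A.Carrier → K.Carrier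
    ι-isHom : IsAlgebraHomomorphism A-algebra K-algebra ι

------------------------------------------------------------------------
-- 𝐭-modules

module TModules {c₁ ℓ₁ a₁ c₂ ℓ₂ a₂} (B : BaseData c₁ ℓ₁ a₁ c₂ ℓ₂ a₂) where

  open BaseData B public

  t : A.Carrier
  t = SkewPolynomial.τ (fieldRawRing F) id

  θ : K.Carrier
  θ = ι t

  open RawSemiringDefinitions (RawRing.rawSemiring (fieldRawRing K)) using (_^_)

  module K⟨τ⟩ = SkewPolynomial (fieldRawRing K) (_^ q)
  module MatK = Matrices (fieldRawRing K)
  open Matrices K⟨τ⟩.rawRing public

  infixr 7 _•_
  _•_ : ∀ {m n} → F.Carrier → Matrix m n → Matrix m n
  (c • M) i j = F→K c K⟨τ⟩.· M i j

  matrixAlgebra : ℕ → RawAlgebra F.Carrier c₂ ℓ₂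
  matrixAlgebra d = record { rawRing = rawRing d ; _•_ = _•_ }

  matrixModule : ℕ → ℕ → RawLeftModule F.Carrier c₂ ℓ₂
  matrixModule m n = record
    { Carrierᴹ = Matrix m n
    ; _≈ᴹ_ = _≈_ ; _+ᴹ_ = _+_ ; _*ₗ_ = _•_ ; 0ᴹ = 0ᴹ ; -ᴹ_ = -_ }

  ∂ : ∀ {m n} → Matrix m n → MatK.Matrix m n
  ∂ M i j = K⟨τ⟩.coeff (M i j) 0

  -- A family of matrices indexed by A, before requiring it to be a 𝐭-module.
  Family : ℕ → Set (c₁ ⊔ c₂)
  Family d = A.Carrier → Matrix d d

  record IsTModule {d} (Φ : Family d) : Set (c₁ ⊔ ℓ₁ ⊔ c₂ ⊔ ℓ₂) where
    field
      isAlgebraHomomorphism : IsAlgebraHomomorphism A-algebra (matrixAlgebra d) Φ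
      N                     : MatK.Matrix d d
      N-nilpotent           : MatK.IsNilpotent N
      ∂Φₜ≈θI+N              : ∂ (Φ t) MatK.≈ (θ MatK.· MatK.I) MatK.+ N

  record TModule (d : ℕ) : Set (c₁ ⊔ ℓ₁ ⊔ c₂ ⊔ ℓ₂) where
    field
      _⟨_⟩      : Family d
      isTModule : IsTModule _⟨_⟩

  open TModule public

  -- f is a morphism from Ψ to Φ.
  IsMorphism : ∀ {e d} → Family e → Family d → Matrix d e → Set ℓ₂
  IsMorphism Ψ Φ f = f * Ψ t ≈ Φ t * f

  -- δ ∈ Der(Φ, Ψ)
  record IsBiderivation {d e} (Φ : Family d) (Ψ : Family e) (δ : A.Carrier → Matrix e d)
    : Set (c₁ ⊔ ℓ₁ ⊔ ℓ₂) where
    field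
      linear  : LeftModuleMorphisms.IsLeftModuleHomomorphism
                  A.rawLeftModule (matrixModule e d) δ
      leibniz : ∀ a b → δ (a A.* b) ≈ Ψ a * δ b + δ a * Φ b

  extension : ∀ {d e} → Family d → Family e → (A.Carrier → Matrix e d) → Family (d ℕ.+ e)
  extension Φ Ψ δ a = Φ a ∥ 0ᴹ
                    ⫽ δ a ∥ Ψ a

  -- 0 → Ψ → X → Φ → 0 is short exact in the category of 𝐭-modules: i is a
  -- kernel of π and π is a cokernel of i.
  record IsShortExact {e x d} (Ψ : Family e) (X : Family x) (Φ : Family d)
    (i : Matrix x e) (π : Matrix d x) : Set (c₁ ⊔ ℓ₁ ⊔ c₂ ⊔ ℓ₂) where
    field
      Ψ-isTModule : IsTModule Ψ
      X-isTModule : IsTModule X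
      Φ-isTModule : IsTModule Φ
      i-morphism  : IsMorphism Ψ X i
      π-morphism  : IsMorphism X Φ π
      π*i≈0       : π * i ≈ 0ᴹ
      kernel      : ∀ {z} (Z : TModule z) (h : Matrix x z) →
                    IsMorphism (Z ⟨_⟩) X h → π * h ≈ 0ᴹ →
                    ∃! _≈_ λ u → IsMorphism (Z ⟨_⟩) Ψ u × i * u ≈ h
      cokernel    : ∀ {z} (Z : TModule z) (h : Matrix z x) →
                    IsMorphism X (Z ⟨_⟩) h → h * i ≈ 0ᴹ →
                    ∃! _≈_ λ u → IsMorphism Φ (Z ⟨_⟩) u × u * π ≈ h

  -- Y, with p₁ : Y → Ξ and p₂ : Y → X, is the pullback of π : X → Φ along
  -- g : Ξ → Φ in the category of 𝐭-modules.
  record IsPullback {x d r y}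
    (X : Family x) (Φ : Family d) (Ξ : Family r) (Y : Family y)
    (π : Matrix d x) (g : Matrix d r) (p₁ : Matrix r y) (p₂ : Matrix x y)
    : Set (c₁ ⊔ ℓ₁ ⊔ c₂ ⊔ ℓ₂) where
    field
      Y-isTModule : IsTModule Y
      p₁-morphism : IsMorphism Y Ξ p₁
      p₂-morphism : IsMorphism Y X p₂
      commutes    : g * p₁ ≈ π * p₂
      universal   : ∀ {z} (Z : TModule z) (h₁ : Matrix r z) (h₂ : Matrix x z) →
                    IsMorphism (Z ⟨_⟩) Ξ h₁ → IsMorphism (Z ⟨_⟩) X h₂ →
                    g * h₁ ≈ π * h₂ →
                    ∃! _≈_ λ u → IsMorphism (Z ⟨_⟩) Y u × p₁ * u ≈ h₁ × p₂ * u ≈ h₂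

  -- Y, with q₁ : Ξ → Y and q₂ : X → Y, is the pushout of i : Ψ → X along
  -- f : Ψ → Ξ in the category of 𝐭-modules.
  record IsPushout {e x r y}
    (Ψ : Family e) (X : Family x) (Ξ : Family r) (Y : Family y)
    (i : Matrix x e) (f : Matrix r e) (q₁ : Matrix y r) (q₂ : Matrix y x)
    : Set (c₁ ⊔ ℓ₁ ⊔ c₂ ⊔ ℓ₂) where
    field
      Y-isTModule : IsTModule Y
      q₁-morphism : IsMorphism Ξ Y q₁
      q₂-morphism : IsMorphism X Y q₂
      commutes    : q₁ * f ≈ q₂ * i
      universal   : ∀ {z} (Z : TModule z) (h₁ : Matrix z r) (h₂ : Matrix z x) →
                    IsMorphism Ξ (Z ⟨_⟩) h₁ → IsMorphism X (Z ⟨_⟩) h₂ →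
                    h₁ * f ≈ h₂ * i →
                    ∃! _≈_ λ u → IsMorphism Y (Z ⟨_⟩) u × u * q₁ ≈ h₁ × u * q₂ ≈ h₂

{-# OPTIONS --safe #-}

-- Both X and Y are block lower triangular, so every claim reduces to
-- identities between block matrices over K{τ}.  The universal maps are forced:
-- u = [ h₁ ; lower block of h₂ ] into the pullback, and
-- u = [ left block of h₂ , h₁ ] out of the pushout.
-- Two points need more than block algebra.  A morphism is only required to
-- commute with the action of t, and δ·g and f·δ are biderivations because it
-- then commutes with the action of all of 𝔽_q[t]; this uses that the scalars
-- from 𝔽_q are central in K{τ}, i.e. c^q = c.  And K{τ} is a ring because
-- x ↦ x^q is additive in characteristic p.

module Submission where

open import Algebra.Apartness.Bundles using (HeytingField)
open import Algebra.Bundles using (CommutativeRing; RawRing; Ring)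
import Algebra.Morphism.Construct.Identity as Identity
open import Algebra.Morphism.Structures using (IsRingHomomorphism; IsSemiringHomomorphism)
open import Algebra.Module.Morphism.Structures using (module LeftModuleMorphisms)
open import Algebra.Properties.Group using (identityˡ-unique; inverseˡ-unique)
import Algebra.Properties.Semiring.Exp as Exp
open import Algebra.Structures using (IsAbelianGroup; IsGroup; IsRing)
open import Data.Fin.Base using (Fin; zero; suc; fromℕ; inject₁; punchIn; splitAt; _↑ˡ_; _↑ʳ_)
open import Data.Fin.Permutation using (Permutation′; permutation; _⟨$⟩ʳ_)
import Data.Fin.Properties as Fin
open import Data.List.Base as List using ([]; _∷_)
open import Data.List.Properties using (map-id)
open import Data.Nat.Base as ℕ using (ℕ; zero; suc; _!; z<s; s<s)
open import Data.Nat.Combinatorics using (_C_; nCk≡n!/k![n-k]!; k![n∸k]!∣n!; nCn≡1)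
open import Data.Nat.Divisibility using (_∣_; _∤_; ∣⇒≤; m∣m*n)
open import Data.Nat.DivMod using (m/n*n≡m)
open import Data.Nat.Primality using (Prime; euclidsLemma; prime⇒nonZero; prime⇒nonTrivial)
import Data.Nat.Properties as ℕ
open import Data.Product.Base using (_×_; _,_; proj₁; ∃-syntax)
open import Data.Sum.Base using (_⊎_; inj₁; inj₂; [_,_]′)
open import Data.Vec.Functional as Vector using (Vector)
open import Data.Vec.Functional.Properties using (lookup-++ˡ; lookup-++ʳ)
open import Function.Base using (_∘_; case_of_; id)
open import Function.Bundles using (Equivalence; Inverse)
open import Level using (Level)
open import Relation.Binary.Bundles using (Setoid)
open import Relation.Binary.PropositionalEquality as ≡ using (_≡_)
import Relation.Binary.Reasoning.Setoid as ≈-Reasoning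
open import Relation.Nullary using (¬_; Dec; yes; no; contradiction)
open import Relation.Nullary.Decidable using (map′)

open import Defs

-- A biderivation may have any constant term at `t`: `∂ (δ t)` need not vanish. It is absorbed into
-- the nilpotent part of `X`, whose diagonal blocks are those of Φ and Ψ; hence the detour through
-- nilpotence of block triangular matrices. `Extension` treats an arbitrary biderivation, so the
-- base changes are 𝐭-modules as soon as δ·g and f·δ are known to be biderivations. The proof of c^q
-- = c has to be constructive. A Heyting field gives neither decidable equality nor the alternative
-- "zero or invertible", and both are extracted from the enumeration of `F` by `Fin q`.

private variable
  c ℓ a c₁ ℓ₁ a₁ c₂ ℓ₂ a₂ : Level

-- Powers in characteristic p and in finite fields

-- Every factor of `k !` is positive and below `p`, hence not divisible by `p`; Euclid's lemma
-- passes this to the product.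
prime∤! : ∀ {p} → Prime p → ∀ k → k ℕ.< p → p ∤ k !
prime∤! pp zero    0<p p∣1 =
  ℕ.<⇒≱ (ℕ.nonTrivial⇒n>1 _ {{prime⇒nonTrivial pp}}) (∣⇒≤ p∣1)
prime∤! pp (suc k) k<p p∣k! = [ (λ p∣k → ℕ.<⇒≱ k<p (∣⇒≤ p∣k)) , prime∤! pp k (ℕ.<⇒≤ k<p) ]′
  (euclidsLemma (suc k) (k !) pp p∣k!)

-- `p` divides `p !`, which is the binomial coefficient times `k ! (p - k) !`, but it divides
-- neither of these two factorials.
prime∣C : ∀ {p} → Prime p → ∀ k → 0 ℕ.< k → k ℕ.< p → p ∣ p C k
prime∣C {p@(suc p′)} pp k 0<k k<p =
  [ (λ h → h) , (λ h → contradiction h p∤k![p∸k]!) ]′ (euclidsLemma (p C k) (k ! ℕ.* (p ℕ.∸ k) !) pp p∣C*)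
  where
  instance _ = k ℕ.!* (p ℕ.∸ k) !≢0
  C*≡p! : (p C k) ℕ.* (k ! ℕ.* (p ℕ.∸ k) !) ≡ p !
  C*≡p! = ≡.trans
    (≡.cong (ℕ._* (k ! ℕ.* (p ℕ.∸ k) !)) (nCk≡n!/k![n-k]! (ℕ.<⇒≤ k<p)))
    (m/n*n≡m (k![n∸k]!∣n! (ℕ.<⇒≤ k<p)))
  p∣C* : p ∣ (p C k) ℕ.* (k ! ℕ.* (p ℕ.∸ k) !)
  p∣C* = ≡.subst (p ∣_) (≡.sym C*≡p!) (m∣m*n (p′ !))
  p∤k![p∸k]! : p ∤ k ! ℕ.* (p ℕ.∸ k) !
  p∤k![p∸k]! h = [ prime∤! pp k k<p , prime∤! pp (p ℕ.∸ k) (ℕ.∸-monoʳ-< 0<k (ℕ.<⇒≤ k<p)) ]′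
    (euclidsLemma (k !) ((p ℕ.∸ k) !) pp h)

module Frobenius (R : CommutativeRing c ℓ) {p} (p-prime : Prime p)
  (char : HasCharacteristic (CommutativeRing.rawRing R) p) where

  open CommutativeRing R hiding (zero)
  open RawRing rawRing using (rawSemiring)
  open import Algebra.Properties.Semiring.Exp semiring
  open import Algebra.Properties.Semiring.Mult semiring renaming (_×_ to _×ᴺ_)
  open import Algebra.Properties.Semiring.Sum semiring
  open import Algebra.Properties.CommutativeSemiring.Exp commutativeSemiring using (^-distrib-*)
  open import Algebra.Properties.CommutativeSemiring.Binomial commutativeSemiring
  open import Algebra.Properties.Group +-group using (∙-cancelˡ)
  open ≈-Reasoning setoid

  ×-zero : ∀ {n} → p ∣ n → ∀ x → n ×ᴺ x ≈ 0#
  ×-zero {n} p∣n x = begin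
    n ×ᴺ x        ≈⟨ ×-congʳ n (*-identityˡ x) ⟨
    n ×ᴺ (1# * x) ≈⟨ ×-assoc-* n 1# x ⟨
    n ×ᴺ 1# * x   ≈⟨ *-congʳ (Equivalence.from (char n) p∣n) ⟩
    0# * x        ≈⟨ zeroˡ x ⟩
    0#            ∎

  -- With a successor as exponent, the binomial sum splits into its first term, `n` middle terms and
  -- its last term. The divisibility stays a hypothesis so that `[x+y]^p` follows by transport along
  -- `suc (pred p) ≡ p`.
  [x+y]^[1+n] : ∀ n → (∀ k → 0 ℕ.< k → k ℕ.< suc n → p ∣ suc n C k) →
                ∀ x y → (x + y) ^ suc n ≈ x ^ suc n + y ^ suc n
  [x+y]^[1+n] n p∣C x y = begin
    (x + y) ^ suc n
      ≈⟨ theorem (suc n) x y ⟩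
    term zero + sum (term ∘ suc)
      ≈⟨ +-congˡ (sum-init-last (term ∘ suc)) ⟩
    term zero + (sum (term ∘ suc ∘ inject₁) + term (fromℕ (suc n)))
      ≈⟨ +-congˡ (+-congʳ (trans (sum-cong-≋ middle) (sum-replicate-zero n))) ⟩
    term zero + (0# + term (fromℕ (suc n)))
      ≈⟨ +-cong first (trans (+-identityˡ _) last) ⟩
    y ^ suc n + x ^ suc n
      ≈⟨ +-comm _ _ ⟩
    x ^ suc n + y ^ suc n ∎
    where
    term : Fin (suc (suc n)) → Carrier
    term = binomialTerm x y (suc n)

    first : term zero ≈ y ^ suc n
    first = trans (+-identityʳ _) (*-identityˡ _)

    middle : ∀ i → term (suc (inject₁ i)) ≈ 0#
    middle i = ×-zero (p∣C _ z<s (s<s (ℕ.≤-<-trans (ℕ.≤-reflexive (Fin.toℕ-inject₁ i)) (Fin.toℕ<n i)))) _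

    last : term (fromℕ (suc n)) ≈ x ^ suc n
    last rewrite Fin.toℕ-fromℕ n | nCn≡1 (suc n) | ℕ.n∸n≡0 n = trans (+-identityʳ _) (*-identityʳ _)

  [x+y]^p : ∀ x y → (x + y) ^ p ≈ x ^ p + y ^ p
  [x+y]^p = ≡.subst (λ n → ∀ x y → (x + y) ^ n ≈ x ^ n + y ^ n) p≡
    ([x+y]^[1+n] (ℕ.pred p) (≡.subst (λ n → ∀ k → 0 ℕ.< k → k ℕ.< n → p ∣ n C k) (≡.sym p≡) (prime∣C p-prime)))
    where
    p≡ : suc (ℕ.pred p) ≡ p
    p≡ = ℕ.suc-pred p {{prime⇒nonZero p-prime}}

  [x+y]^[p^m] : ∀ m x y → (x + y) ^ (p ℕ.^ m) ≈ x ^ (p ℕ.^ m) + y ^ (p ℕ.^ m)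
  [x+y]^[p^m] zero    x y = trans (*-identityʳ _) (sym (+-cong (*-identityʳ _) (*-identityʳ _)))
  [x+y]^[p^m] (suc m) x y = begin
    (x + y) ^ (p ℕ.* p ℕ.^ m)                     ≈⟨ ^-assocʳ (x + y) p _ ⟨
    ((x + y) ^ p) ^ (p ℕ.^ m)                     ≈⟨ ^-congˡ (p ℕ.^ m) ([x+y]^p x y) ⟩
    (x ^ p + y ^ p) ^ (p ℕ.^ m)                   ≈⟨ [x+y]^[p^m] m (x ^ p) (y ^ p) ⟩
    (x ^ p) ^ (p ℕ.^ m) + (y ^ p) ^ (p ℕ.^ m)     ≈⟨ +-cong (^-assocʳ x p _) (^-assocʳ y p _) ⟩
    x ^ (p ℕ.* p ℕ.^ m) + y ^ (p ℕ.* p ℕ.^ m)     ∎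

  frobenius-isSemiringHomomorphism : ∀ {q} m → q ≡ p ℕ.^ m →
    IsSemiringHomomorphism rawSemiring rawSemiring (_^ q)
  frobenius-isSemiringHomomorphism m ≡.refl = record
    { isNearSemiringHomomorphism = record
      { +-isMonoidHomomorphism = record
        { isMagmaHomomorphism = record
          { isRelHomomorphism = record { cong = ^-congˡ q }
          ; homo = [x+y]^[p^m] m }
        -- Additivity gives 0^q + 0^q = 0^q + 0; cancelling 0^q avoids having to exhibit `p ^ m` as
        -- a successor.
        ; ε-homo = ∙-cancelˡ (0# ^ q) _ _ (begin
            0# ^ q + 0# ^ q ≈⟨ [x+y]^[p^m] m 0# 0# ⟨
            (0# + 0#) ^ q   ≈⟨ ^-congˡ q (+-identityʳ 0#) ⟩
            0# ^ q          ≈⟨ +-identityʳ _ ⟨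
            0# ^ q + 0#     ∎) }
      ; *-homo = λ x y → ^-distrib-* x y q }
    ; 1#-homo = 1^ q }
    where
    q = p ℕ.^ m
    1^ : ∀ n → 1# ^ n ≈ 1#
    1^ zero    = refl
    1^ (suc n) = trans (*-identityˡ _) (1^ n)

-- Fixed points of the q-power map

module FiniteField (F : HeytingField c ℓ a) {q}
  (F-finite : Inverse (≡.setoid (Fin q)) (CommutativeRing.setoid (fieldRing F))) where

  open CommutativeRing (fieldRing F) hiding (zero)
  open HeytingField F using (#⇒invertible; tight)
  open import Algebra.Properties.Semiring.Exp semiring using (_^_; ^-congˡ)
  open import Algebra.Properties.CommutativeMonoid.Sum *-commutativeMonoid
    renaming (sum to ∏; sum-cong-≋ to ∏-cong; sum-permute to ∏-permute; sum-remove to ∏-remove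
             ; sum-replicate to ∏-replicate; sum-replicate-zero to ∏-replicate-one; ∑-distrib-+ to ∏-distrib-*)
  open ≈-Reasoning setoid
  private module F = Inverse F-finite

  infix 4 _≟_
  -- Equality becomes decidable by comparing indices under the enumeration.
  _≟_ : ∀ x y → Dec (x ≈ y)
  x ≟ y = map′ from-injective F.from-cong (F.from x Fin.≟ F.from y)
    where
    from-injective : F.from x ≡ F.from y → x ≈ y
    from-injective eq = trans (sym (F.strictlyInverseˡ x)) (trans (F.to-cong eq) (F.strictlyInverseˡ y))

  Unit : Carrier → Set _
  Unit x = ∃[ y ] y * x ≈ 1#

  -- Apartness is not known to be decidable, so an inverse is searched for
  -- among the q elements; tightness shows that x ≈ 0 if there is none.
  ≈0-or-unit : ∀ x → x ≈ 0# ⊎ Unit x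
  ≈0-or-unit x with Fin.any? (λ i → F.to i * x ≟ 1#)
  ... | yes (i , eq) = inj₂ (F.to i , eq)
  ... | no  ¬inv     = inj₁ (proj₁ (tight x 0#) (λ x#0 → ¬inv (inverse (#⇒invertible x#0))))
    where
    -- Apartness from 0 yields an inverse of the difference `x - 0#`; passing to its index
    -- contradicts the failed search.
    inverse : _ → ∃[ i ] F.to i * x ≈ 1#
    inverse (y , y*[x-0]≈1 , _) = F.from y , (begin
      F.to (F.from y) * x   ≈⟨ *-congʳ (F.strictlyInverseˡ y) ⟩
      y * x                 ≈⟨ *-congˡ (+-identityʳ x) ⟨
      y * (x + 0#)          ≈⟨ *-congˡ (+-congˡ (-0#≈0#)) ⟨
      y * (x - 0#)          ≈⟨ y*[x-0]≈1 ⟩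
      1#                    ∎)
      where open import Algebra.Properties.Ring ring using (-0#≈0#)

  unit-cancelˡ : ∀ {x y z} → Unit x → x * y ≈ x * z → y ≈ z
  unit-cancelˡ {x} {y} {z} (u , ux≈1) xy≈xz = begin
    y           ≈⟨ *-identityˡ y ⟨
    1# * y      ≈⟨ *-congʳ ux≈1 ⟨
    u * x * y   ≈⟨ *-assoc u x y ⟩
    u * (x * y) ≈⟨ *-congˡ xy≈xz ⟩
    u * (x * z) ≈⟨ *-assoc u x z ⟨
    u * x * z   ≈⟨ *-congʳ ux≈1 ⟩
    1# * z      ≈⟨ *-identityˡ z ⟩
    z           ∎

  unit-* : ∀ {x y} → Unit x → Unit y → Unit (x * y)
  unit-* {x} {y} (u , ux≈1) (v , vy≈1) = u * v , (begin
    u * v * (x * y)   ≈⟨ *-cong (*-comm u v) refl ⟩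
    v * u * (x * y)   ≈⟨ *-assoc v u _ ⟩
    v * (u * (x * y)) ≈⟨ *-congˡ (*-assoc u x y) ⟨
    v * (u * x * y)   ≈⟨ *-congˡ (trans (*-congʳ ux≈1) (*-identityˡ y)) ⟩
    v * y             ≈⟨ vy≈1 ⟩
    1#                ∎)

  unit-∏ : ∀ {n} (f : Fin n → Carrier) → (∀ i → Unit (f i)) → Unit (∏ f)
  unit-∏ {zero}  f units = 1# , *-identityˡ 1#
  unit-∏ {suc n} f units = unit-* (units zero) (unit-∏ (f ∘ suc) (units ∘ suc))

  ∏-single : ∀ {n} (f : Fin n → Carrier) i → (∀ j → j ≡.≢ i → f j ≈ 1#) → ∏ f ≈ f i
  ∏-single {suc n} f i f≈1 = begin
    ∏ f                       ≈⟨ ∏-remove {i = i} f ⟩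
    f i * ∏ (f ∘ punchIn i)   ≈⟨ *-congˡ (∏-cong (λ j → f≈1 _ (Fin.punchInᵢ≢i i j))) ⟩
    f i * ∏ {n} (λ _ → 1#)    ≈⟨ *-congˡ (∏-replicate-one n) ⟩
    f i * 1#                  ≈⟨ *-identityʳ (f i) ⟩
    f i                       ∎

  -- One selector serves all three families of `unit^q`. They test the same `F.to i ≟ 0#`, so a
  -- single `with` evaluates them together.
  ifZero : Carrier → Carrier → Carrier → Carrier
  ifZero y z x with x ≟ 0#
  ... | yes _ = y
  ... | no  _ = z

  ifZero-yes : ∀ {y z x} → x ≈ 0# → ifZero y z x ≈ y
  ifZero-yes {x = x} x≈0 with x ≟ 0#
  ... | yes _  = refl
  ... | no x≉0 = contradiction x≈0 x≉0

  ifZero-no : ∀ {y z x} → ¬ x ≈ 0# → ifZero y z x ≈ z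
  ifZero-no {x = x} x≉0 with x ≟ 0#
  ... | yes x≈0 = contradiction x≈0 x≉0
  ... | no _    = refl

  -- Multiplication by a unit c permutes F, so the product of the nonzero
  -- elements absorbs the product of c over the nonzero indices, which is
  -- therefore 1; the index of 0 supplies the missing factor of c ^ q.
  unit^q : ∀ {c} → Unit c → c ^ q ≈ c
  unit^q {c} c-unit@(c⁻¹ , c⁻¹c≈1) = begin
    c ^ q                       ≈⟨ ∏-replicate q ⟨
    ∏ {q} (λ _ → c)             ≈⟨ ∏-cong atNonzero*atZero ⟨
    ∏ (λ i → atNonzero i * atZero i) ≈⟨ ∏-distrib-* atNonzero atZero ⟩
    ∏ atNonzero * ∏ atZero      ≈⟨ *-cong ∏atNonzero≈1 ∏atZero≈c ⟩
    1# * c                      ≈⟨ *-identityˡ c ⟩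
    c                           ∎
    where
    -- `nonzero` puts 1 in place of the element 0, so that its product is a unit and can be
    -- cancelled.
    nonzero atNonzero atZero : Fin q → Carrier
    nonzero   i = ifZero 1# (F.to i) (F.to i)
    atNonzero i = ifZero 1# c        (F.to i)
    atZero    i = ifZero c  1#       (F.to i)

    atNonzero*atZero : ∀ i → atNonzero i * atZero i ≈ c
    atNonzero*atZero i with F.to i ≟ 0#
    ... | yes _ = *-identityˡ c
    ... | no  _ = *-identityʳ c

    ∏atZero≈c : ∏ atZero ≈ c
    ∏atZero≈c = trans
      (∏-single atZero (F.from 0#) λ j j≢0 → ifZero-no λ j≈0 →
        j≢0 (≡.trans (≡.sym (F.strictlyInverseʳ j)) (F.from-cong j≈0)))
      (ifZero-yes (F.strictlyInverseˡ 0#))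

    multiplication : ∀ x y → y * x ≈ 1# → ∀ i → F.from (y * F.to (F.from (x * F.to i))) ≡ i
    multiplication x y yx≈1 i = ≡.trans (F.from-cong (begin
      y * F.to (F.from (x * F.to i)) ≈⟨ *-congˡ (F.strictlyInverseˡ _) ⟩
      y * (x * F.to i)               ≈⟨ *-assoc y x _ ⟨
      y * x * F.to i                 ≈⟨ trans (*-congʳ yx≈1) (*-identityˡ _) ⟩
      F.to i                         ∎)) (F.strictlyInverseʳ i)

    π : Permutation′ q
    π = permutation (λ i → F.from (c * F.to i)) (λ i → F.from (c⁻¹ * F.to i))
      (multiplication c⁻¹ c (trans (*-comm c c⁻¹) c⁻¹c≈1)) (multiplication c c⁻¹ c⁻¹c≈1)

    nonzero-unit : ∀ i → Unit (nonzero i)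
    nonzero-unit i with F.to i ≟ 0# | ≈0-or-unit (F.to i)
    ... | yes _  | _           = 1# , *-identityˡ 1#
    ... | no i≉0 | inj₁ i≈0    = contradiction i≈0 i≉0
    ... | no _   | inj₂ i-unit = i-unit

    -- Multiplication by `c` fixes 0, where both sides are 1. It keeps nonzero elements nonzero
    -- because the unit `c` cancels, and there it contributes one factor `c`.
    nonzero-π : ∀ i → nonzero (π ⟨$⟩ʳ i) ≈ nonzero i * atNonzero i
    nonzero-π i with F.to i ≟ 0#
    ... | yes i≈0 = trans
      (ifZero-yes (trans (F.strictlyInverseˡ _) (trans (*-congˡ i≈0) (zeroʳ c)))) (sym (*-identityʳ 1#))
    ... | no i≉0 = trans
      (ifZero-no λ ci≈0 → i≉0 (unit-cancelˡ c-unit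
        (trans (trans (sym (F.strictlyInverseˡ _)) ci≈0) (sym (zeroʳ c)))))
      (trans (F.strictlyInverseˡ _) (*-comm c _))

    ∏atNonzero≈1 : ∏ atNonzero ≈ 1#
    ∏atNonzero≈1 = unit-cancelˡ (unit-∏ nonzero nonzero-unit) (begin
      ∏ nonzero * ∏ atNonzero             ≈⟨ ∏-distrib-* nonzero atNonzero ⟨
      ∏ (λ i → nonzero i * atNonzero i)   ≈⟨ ∏-cong nonzero-π ⟨
      ∏ (λ i → nonzero (π ⟨$⟩ʳ i))        ≈⟨ ∏-permute nonzero π ⟨
      ∏ nonzero                           ≈⟨ *-identityʳ _ ⟨
      ∏ nonzero * 1#                      ∎)

  x^q≈x : ∀ x → x ^ q ≈ x
  x^q≈x x with ≈0-or-unit x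
  ... | inj₂ x-unit = unit^q x-unit
  -- The index of 0 shows that `Fin q` is inhabited, so `q` is a successor; for `q` = 0 the power
  -- would be 1.
  ... | inj₁ x≈0    = trans (^-congˡ q x≈0) (trans (0^ (F.from 0#)) (sym x≈0))
    where
    0^ : ∀ {n} → Fin n → 0# ^ n ≈ 0#
    0^ {suc n} _ = zeroˡ (0# ^ n)

-- The ring laws are stated for the given raw operations, so that the results apply to the raw rings
-- of `BaseData` and `TModules` without conversion.
FormsRing : RawRing c ℓ → Set _
FormsRing R = IsRing _≈_ _+_ _*_ -_ 0# 1#
  where open RawRing R

-- Skew polynomials

module SkewPolynomialProperties (R : RawRing c ℓ)
  (isRing : FormsRing R)
  {σ : RawRing.Carrier R → RawRing.Carrier R}
  (σ-isHom : IsSemiringHomomorphism (RawRing.rawSemiring R) (RawRing.rawSemiring R) σ) where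

  private
    R-ring : Ring c ℓ
    R-ring = record { isRing = isRing }
    module R = Ring R-ring
    module σ = IsSemiringHomomorphism σ-isHom
    module ≈ᴿ = ≈-Reasoning R.setoid
  open import Algebra.Properties.CommutativeSemigroup R.+-commutativeSemigroup
    using () renaming (interchange to R-interchange)
  open import Algebra.Properties.Ring R-ring using (-0#≈0#)
  open SkewPolynomial R σ
  open RawRing rawRing using (-_)

  ≈-setoid : Setoid c ℓ
  ≈-setoid = record
    { _≈_ = _≈_
    ; isEquivalence = record
      { refl  = mk≈ λ _ → R.refl
      ; sym   = λ f≈g → mk≈ λ n → R.sym (coeff-≈ f≈g n)
      ; trans = λ f≈g g≈h → mk≈ λ n → R.trans (coeff-≈ f≈g n) (coeff-≈ g≈h n) } }
  open Setoid ≈-setoid using (refl; sym; trans; isEquivalence)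
  open ≈-Reasoning ≈-setoid

  infixr 5 _∷-cong_
  _∷-cong_ : ∀ {a b f g} → a R.≈ b → f ≈ g → a ∷ f ≈ b ∷ g
  a≈b ∷-cong f≈g = mk≈ λ { zero → a≈b ; (suc n) → coeff-≈ f≈g n }

  head-≈ : ∀ {a b f g} → a ∷ f ≈ b ∷ g → a R.≈ b
  head-≈ eq = coeff-≈ eq 0

  tail-≈ : ∀ {a b f g} → a ∷ f ≈ b ∷ g → f ≈ g
  tail-≈ eq = mk≈ λ n → coeff-≈ eq (suc n)

  0∷[] : R.0# ∷ [] ≈ []
  0∷[] = mk≈ λ { zero → R.refl ; (suc n) → R.refl }

  coeff-+ : ∀ f g n → coeff (f + g) n R.≈ coeff f n R.+ coeff g n
  coeff-+ []      g       n       = R.sym (R.+-identityˡ _)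
  coeff-+ (a ∷ f) []      n       = R.sym (R.+-identityʳ _)
  coeff-+ (a ∷ f) (b ∷ g) zero    = R.refl
  coeff-+ (a ∷ f) (b ∷ g) (suc n) = coeff-+ f g n

  -- `h` has to fix 0 because coefficients beyond the end of the list are read as 0. Scalar
  -- multiplication, negation and `σ` are the instances.
  coeff-map : ∀ {h} → h R.0# R.≈ R.0# → ∀ f n → coeff (List.map h f) n R.≈ h (coeff f n)
  coeff-map h0≈0 []      n       = R.sym h0≈0
  coeff-map h0≈0 (a ∷ f) zero    = R.refl
  coeff-map h0≈0 (a ∷ f) (suc n) = coeff-map h0≈0 f n

  coeff-· : ∀ a f n → coeff (a · f) n R.≈ a R.* coeff f n
  coeff-· a = coeff-map (R.zeroʳ a)

  coeff-- : ∀ f n → coeff ((- f)) n R.≈ R.- coeff f n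
  coeff-- = coeff-map -0#≈0#

  coeff-σ : ∀ f n → coeff (List.map σ f) n R.≈ σ (coeff f n)
  coeff-σ = coeff-map σ.0#-homo

  +-cong : ∀ {f f′ g g′} → f ≈ f′ → g ≈ g′ → f + g ≈ f′ + g′
  +-cong {f} {f′} {g} {g′} f≈f′ g≈g′ = mk≈ λ n → R.trans (coeff-+ f g n)
    (R.trans (R.+-cong (coeff-≈ f≈f′ n) (coeff-≈ g≈g′ n)) (R.sym (coeff-+ f′ g′ n)))

  +-assoc : ∀ f g h → (f + g) + h ≈ f + (g + h)
  +-assoc f g h = mk≈ λ n → ≈ᴿ.begin
    coeff ((f + g) + h) n
      ≈ᴿ.≈⟨ R.trans (coeff-+ (f + g) h n) (R.+-congʳ (coeff-+ f g n)) ⟩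
    coeff f n R.+ coeff g n R.+ coeff h n        ≈ᴿ.≈⟨ R.+-assoc _ _ _ ⟩
    coeff f n R.+ (coeff g n R.+ coeff h n)
      ≈ᴿ.≈⟨ R.trans (coeff-+ f (g + h) n) (R.+-congˡ (coeff-+ g h n)) ⟨
    coeff (f + (g + h)) n                        ≈ᴿ.∎

  +-comm : ∀ f g → f + g ≈ g + f
  +-comm f g = mk≈ λ n → R.trans (coeff-+ f g n) (R.trans (R.+-comm _ _) (R.sym (coeff-+ g f n)))

  +-identityʳ : ∀ f → f + [] ≈ f
  +-identityʳ []      = refl
  +-identityʳ (a ∷ f) = refl

  +-inverseʳ : ∀ f → f + (- f) ≈ []
  +-inverseʳ f = mk≈ λ n → R.trans (coeff-+ f ((- f)) n)
    (R.trans (R.+-congˡ (coeff-- f n)) (R.-‿inverseʳ _))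

  -‿cong : ∀ {f g} → f ≈ g → (- f) ≈ (- g)
  -‿cong {f} {g} f≈g = mk≈ λ n → R.trans (coeff-- f n)
    (R.trans (R.-‿cong (coeff-≈ f≈g n)) (R.sym (coeff-- g n)))

  +-isAbelianGroup : IsAbelianGroup _≈_ _+_ [] -_
  +-isAbelianGroup = record
    { isGroup = record
      { isMonoid = record
        { isSemigroup = record
          { isMagma = record { isEquivalence = isEquivalence ; ∙-cong = +-cong }
          ; assoc   = +-assoc }
        ; identity = (λ _ → refl) , +-identityʳ }
      ; inverse = (λ f → trans (+-comm ((- f)) f) (+-inverseʳ f)) , +-inverseʳ
      ; ⁻¹-cong = -‿cong }
    ; comm = +-comm }

  +-congˡ : ∀ {f g g′} → g ≈ g′ → f + g ≈ f + g′
  +-congˡ {f} = +-cong (refl {f})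

  +-congʳ : ∀ {f g g′} → g ≈ g′ → g + f ≈ g′ + f
  +-congʳ {f} g≈g′ = +-cong g≈g′ (refl {f})

  +-interchange : ∀ f g h k → (f + g) + (h + k) ≈ (f + h) + (g + k)
  +-interchange f g h k = mk≈ λ n → ≈ᴿ.begin
    coeff ((f + g) + (h + k)) n  ≈ᴿ.≈⟨ coeffs f g h k n ⟩
    _                            ≈ᴿ.≈⟨ R-interchange _ _ _ _ ⟩
    _                            ≈ᴿ.≈⟨ coeffs f h g k n ⟨
    coeff ((f + h) + (g + k)) n  ≈ᴿ.∎
    where
    coeffs : ∀ f g h k n → coeff ((f + g) + (h + k)) n R.≈
             (coeff f n R.+ coeff g n) R.+ (coeff h n R.+ coeff k n)
    coeffs f g h k n = R.trans (coeff-+ (f + g) (h + k) n) (R.+-cong (coeff-+ f g n) (coeff-+ h k n))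

  ·-cong : ∀ {a b f g} → a R.≈ b → f ≈ g → a · f ≈ b · g
  ·-cong {a} {b} {f} {g} a≈b f≈g = mk≈ λ n → R.trans (coeff-· a f n)
    (R.trans (R.*-cong a≈b (coeff-≈ f≈g n)) (R.sym (coeff-· b g n)))

  ·-distribˡ-+ : ∀ a f g → a · (f + g) ≈ a · f + a · g
  ·-distribˡ-+ a f g = mk≈ λ n → ≈ᴿ.begin
    coeff (a · (f + g)) n
      ≈ᴿ.≈⟨ R.trans (coeff-· a (f + g) n) (R.*-congˡ (coeff-+ f g n)) ⟩
    a R.* (coeff f n R.+ coeff g n)                ≈ᴿ.≈⟨ R.distribˡ a _ _ ⟩
    a R.* coeff f n R.+ a R.* coeff g n
      ≈ᴿ.≈⟨ R.trans (coeff-+ (a · f) (a · g) n) (R.+-cong (coeff-· a f n) (coeff-· a g n)) ⟨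
    coeff (a · f + a · g) n                        ≈ᴿ.∎

  ·-distribʳ-+ : ∀ f a b → (a R.+ b) · f ≈ a · f + b · f
  ·-distribʳ-+ f a b = mk≈ λ n → ≈ᴿ.begin
    coeff ((a R.+ b) · f) n                        ≈ᴿ.≈⟨ coeff-· (a R.+ b) f n ⟩
    (a R.+ b) R.* coeff f n                        ≈ᴿ.≈⟨ R.distribʳ _ a b ⟩
    a R.* coeff f n R.+ b R.* coeff f n
      ≈ᴿ.≈⟨ R.trans (coeff-+ (a · f) (b · f) n) (R.+-cong (coeff-· a f n) (coeff-· b f n)) ⟨
    coeff (a · f + b · f) n                        ≈ᴿ.∎

  ·-assoc : ∀ a b f → (a R.* b) · f ≈ a · (b · f)
  ·-assoc a b f = mk≈ λ n → R.trans (coeff-· (a R.* b) f n) (R.trans (R.*-assoc a b _)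
    (R.sym (R.trans (coeff-· a (b · f) n) (R.*-congˡ (coeff-· b f n)))))

  ·-identity : ∀ f → R.1# · f ≈ f
  ·-identity f = mk≈ λ n → R.trans (coeff-· R.1# f n) (R.*-identityˡ _)

  ·-zeroˡ : ∀ f → R.0# · f ≈ []
  ·-zeroˡ f = mk≈ λ n → R.trans (coeff-· R.0# f n) (R.zeroˡ _)

  τ*-cong : ∀ {f g} → f ≈ g → τ* f ≈ τ* g
  τ*-cong {f} {g} f≈g = R.refl ∷-cong mk≈ λ n →
    R.trans (coeff-σ f n) (R.trans (σ.⟦⟧-cong (coeff-≈ f≈g n)) (R.sym (coeff-σ g n)))

  τ*-+ : ∀ f g → τ* (f + g) ≈ τ* f + τ* g
  τ*-+ f g = R.sym (R.+-identityˡ R.0#) ∷-cong mk≈ λ n → ≈ᴿ.begin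
    coeff (List.map σ (f + g)) n              ≈ᴿ.≈⟨ R.trans (coeff-σ (f + g) n) (σ.⟦⟧-cong (coeff-+ f g n)) ⟩
    σ (coeff f n R.+ coeff g n)               ≈ᴿ.≈⟨ σ.+-homo _ _ ⟩
    σ (coeff f n) R.+ σ (coeff g n)
      ≈ᴿ.≈⟨ R.trans (coeff-+ (List.map σ f) _ n) (R.+-cong (coeff-σ f n) (coeff-σ g n)) ⟨
    coeff (List.map σ f + List.map σ g) n     ≈ᴿ.∎

  τ*-· : ∀ a f → τ* (a · f) ≈ σ a · (τ* f)
  τ*-· a f = R.sym (R.zeroʳ (σ a)) ∷-cong mk≈ λ n → ≈ᴿ.begin
    coeff (List.map σ (a · f)) n              ≈ᴿ.≈⟨ R.trans (coeff-σ (a · f) n) (σ.⟦⟧-cong (coeff-· a f n)) ⟩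
    σ (a R.* coeff f n)                       ≈ᴿ.≈⟨ σ.*-homo _ _ ⟩
    σ a R.* σ (coeff f n)
      ≈ᴿ.≈⟨ R.trans (coeff-· (σ a) (List.map σ f) n) (R.*-congˡ (coeff-σ f n)) ⟨
    coeff (σ a · List.map σ f) n              ≈ᴿ.∎

  *-congˡ : ∀ f {g g′} → g ≈ g′ → f * g ≈ f * g′
  *-congˡ []      g≈g′ = refl
  *-congˡ (a ∷ f) g≈g′ = +-cong (·-cong R.refl g≈g′) (*-congˡ f (τ*-cong g≈g′))

  -- Trailing zeros allow a nonempty list to equal `[]`, whereas `_*_` recurses on the list itself.
  -- This settles the cases of unequal length in `*-congʳ`.
  ≈[]⇒*≈[] : ∀ f g → f ≈ [] → f * g ≈ []
  ≈[]⇒*≈[] []      g f≈0 = refl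
  ≈[]⇒*≈[] (a ∷ f) g f≈0 = begin
    a · g + f * (τ* g)
      ≈⟨ +-cong (·-cong (coeff-≈ f≈0 0) refl) (≈[]⇒*≈[] f (τ* g) (mk≈ λ n → coeff-≈ f≈0 (suc n))) ⟩
    R.0# · g + []      ≈⟨ +-identityʳ _ ⟩
    R.0# · g           ≈⟨ ·-zeroˡ g ⟩
    []                 ∎

  *-congʳ : ∀ {f f′} g → f ≈ f′ → f * g ≈ f′ * g
  *-congʳ {[]}    {f′}     g f≈f′ = sym (≈[]⇒*≈[] f′ g (sym f≈f′))
  *-congʳ {a ∷ f} {[]}     g f≈f′ = ≈[]⇒*≈[] (a ∷ f) g f≈f′
  *-congʳ {a ∷ f} {b ∷ f′} g f≈f′ =
    +-cong (·-cong (head-≈ f≈f′) refl) (*-congʳ (τ* g) (tail-≈ f≈f′))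

  *-distribʳ-+ : ∀ h f g → (f + g) * h ≈ f * h + g * h
  *-distribʳ-+ h []      g       = refl
  *-distribʳ-+ h (a ∷ f) []      = sym (+-identityʳ _)
  *-distribʳ-+ h (a ∷ f) (b ∷ g) = begin
    (a R.+ b) · h + (f + g) * (τ* h)
      ≈⟨ +-cong (·-distribʳ-+ h a b) (*-distribʳ-+ (τ* h) f g) ⟩
    a · h + b · h + (f * (τ* h) + g * (τ* h))         ≈⟨ +-interchange (a · h) (b · h) _ _ ⟩
    a · h + f * (τ* h) + (b · h + g * (τ* h))         ∎

  *-distribˡ-+ : ∀ f g h → f * (g + h) ≈ f * g + f * h
  *-distribˡ-+ []      g h = refl
  *-distribˡ-+ (a ∷ f) g h = begin
    a · (g + h) + f * (τ* (g + h))                    ≈⟨ +-cong (·-distribˡ-+ a g h) (*-congˡ f (τ*-+ g h)) ⟩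
    a · g + a · h + f * (τ* g + τ* h)                 ≈⟨ +-congˡ (*-distribˡ-+ f (τ* g) (τ* h)) ⟩
    a · g + a · h + (f * (τ* g) + f * (τ* h))         ≈⟨ +-interchange (a · g) (a · h) _ _ ⟩
    a · g + f * (τ* g) + (a · h + f * (τ* h))         ∎

  ·-*-assoc : ∀ a f g → (a · f) * g ≈ a · (f * g)
  ·-*-assoc a []      g = refl
  ·-*-assoc a (b ∷ f) g = begin
    (a R.* b) · g + (a · f) * (τ* g)   ≈⟨ +-cong (·-assoc a b g) (·-*-assoc a f (τ* g)) ⟩
    a · (b · g) + a · (f * (τ* g))     ≈⟨ ·-distribˡ-+ a (b · g) _ ⟨
    a · (b · g + f * (τ* g))           ∎

  -- The commutation rule of τ, extended from scalars to all of `f`. Induction reduces it to `τ*-·`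
  -- and `τ*-+`, that is to `σ` being multiplicative and additive.
  σ-*-τ* : ∀ f g → List.map σ f * (τ* g) ≈ τ* (f * g)
  σ-*-τ* []      g = sym 0∷[]
  σ-*-τ* (a ∷ f) g = begin
    σ a · (τ* g) + List.map σ f * (τ* (τ* g))   ≈⟨ +-cong (sym (τ*-· a g)) (σ-*-τ* f (τ* g)) ⟩
    τ* (a · g) + τ* (f * (τ* g))                ≈⟨ τ*-+ (a · g) _ ⟨
    τ* (a · g + f * (τ* g))                     ∎

  τ*-*-assoc : ∀ f g → (τ* f) * g ≈ τ* (f * g)
  τ*-*-assoc f g = trans (+-congʳ (·-zeroˡ g)) (σ-*-τ* f g)

  -- Multiplying by the tail of `f` shifts the right factor, so the induction hypothesis is taken at
  -- `τ* g`; `τ*-*-assoc` then pulls τ out of the product.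
  *-assoc : ∀ f g h → (f * g) * h ≈ f * (g * h)
  *-assoc []      g h = refl
  *-assoc (a ∷ f) g h = begin
    (a · g + f * (τ* g)) * h        ≈⟨ *-distribʳ-+ h (a · g) _ ⟩
    (a · g) * h + (f * (τ* g)) * h  ≈⟨ +-cong (·-*-assoc a g h) (*-assoc f (τ* g) h) ⟩
    a · (g * h) + f * ((τ* g) * h)  ≈⟨ +-congˡ (*-congˡ f (τ*-*-assoc g h)) ⟩
    a · (g * h) + f * (τ* (g * h))  ∎

  *-identityˡ : ∀ f → constant R.1# * f ≈ f
  *-identityˡ f = trans (+-identityʳ _) (·-identity f)

  -- 0 ∷ f is f τ.
  *-0∷ : ∀ f g → f * (R.0# ∷ g) ≈ R.0# ∷ (f * g)
  *-0∷ []      g = sym 0∷[]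
  *-0∷ (a ∷ f) g = begin
    a · (R.0# ∷ g) + f * (τ* (R.0# ∷ g))
      ≈⟨ +-cong (R.zeroʳ a ∷-cong refl) (*-congˡ f (R.refl ∷-cong σ.0#-homo ∷-cong refl)) ⟩
    (R.0# ∷ a · g) + f * (R.0# ∷ τ* g)           ≈⟨ +-congˡ (*-0∷ f (τ* g)) ⟩
    (R.0# ∷ a · g) + (R.0# ∷ (f * (τ* g)))       ≈⟨ R.+-identityˡ R.0# ∷-cong refl ⟩
    R.0# ∷ (a · g + f * (τ* g))                  ∎

  *-identityʳ : ∀ f → f * constant R.1# ≈ f
  *-identityʳ []      = refl
  *-identityʳ (a ∷ f) = begin
    (a R.* R.1# ∷ []) + f * (R.0# ∷ constant (σ R.1#))
      ≈⟨ +-congˡ (*-congˡ f (R.refl ∷-cong σ.1#-homo ∷-cong refl)) ⟩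
    (a R.* R.1# ∷ []) + f * (R.0# ∷ constant R.1#)      ≈⟨ +-congˡ (*-0∷ f (constant R.1#)) ⟩
    (a R.* R.1# ∷ []) + (R.0# ∷ (f * constant R.1#))
      ≈⟨ R.trans (R.+-identityʳ _) (R.*-identityʳ a) ∷-cong *-identityʳ f ⟩
    a ∷ f                                               ∎

  skew-isRing : IsRing _≈_ _+_ _*_ -_ [] (constant R.1#)
  skew-isRing = record
    { +-isAbelianGroup = +-isAbelianGroup
    ; *-cong           = λ {f} {f′} {g} f≈f′ g≈g′ → trans (*-congʳ g f≈f′) (*-congˡ f′ g≈g′)
    ; *-assoc          = *-assoc
    ; *-identity       = *-identityˡ , *-identityʳ
    ; distrib          = *-distribˡ-+ , *-distribʳ-+ }

  -- Moving `a` past τ turns it into `σ a`, so a scalar fixed by `σ` passes every power of τ, and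
  -- commutativity moves it past the coefficients.
  *-·-comm : (∀ a b → a R.* b R.≈ b R.* a) → ∀ {a} → σ a R.≈ a → ∀ f g → f * (a · g) ≈ a · (f * g)
  *-·-comm comm {a} σa≈a []      g = refl
  *-·-comm comm {a} σa≈a (b ∷ f) g = begin
    b · (a · g) + f * (τ* (a · g))
      ≈⟨ +-cong (trans (trans (sym (·-assoc b a g)) (·-cong (comm b a) refl)) (·-assoc a b g)) (*-congˡ f (trans (τ*-· a g) (·-cong σa≈a refl))) ⟩
    a · (b · g) + f * (a · (τ* g))    ≈⟨ +-congˡ (*-·-comm comm σa≈a f (τ* g)) ⟩
    a · (b · g) + a · (f * (τ* g))    ≈⟨ ·-distribˡ-+ a (b · g) _ ⟨
    a · (b · g + f * (τ* g))          ∎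

  -- One step of Horner's scheme. Coefficients stand to the left of τ, so multiplying by τ twists
  -- the tail; with `σ` the identity this builds every polynomial from scalars and `t`.
  a∷σf≈a·1+τf : ∀ a f → a ∷ List.map σ f ≈ a · constant R.1# + τ * f
  a∷σf≈a·1+τf a f = begin
    a ∷ List.map σ f                  ≈⟨ R.trans (R.+-identityʳ _) (R.*-identityʳ a) ∷-cong refl ⟨
    a · constant R.1# + τ* f          ≈⟨ +-congˡ {a · constant R.1#} τf≈ ⟨
    a · constant R.1# + τ * f         ∎
    where
    τf≈ : τ * f ≈ τ* f
    τf≈ = begin
      R.0# · f + (R.1# · (τ* f) + []) ≈⟨ +-cong (·-zeroˡ f) (trans (+-identityʳ _) (·-identity (τ* f))) ⟩
      τ* f                            ∎

-- Block matrices

module MatrixProperties (R : RawRing c ℓ) (isRing : FormsRing R) where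

  private
    R-ring : Ring c ℓ
    R-ring = record { isRing = isRing }
    module R = Ring R-ring
    module ≈ᴿ = ≈-Reasoning R.setoid
  open import Algebra.Properties.Semiring.Sum R.semiring
  open Matrices R

  private variable
    k l m m′ n n′ : ℕ

  ≈-setoid : ℕ → ℕ → Setoid c ℓ
  ≈-setoid m n = record
    { Carrier = Matrix m n
    ; _≈_     = _≈_
    ; isEquivalence = record
      { refl  = λ _ _ → R.refl
      ; sym   = λ p i j → R.sym (p i j)
      ; trans = λ p q i j → R.trans (p i j) (q i j) } }

  refl : {M : Matrix m n} → M ≈ M
  refl _ _ = R.refl

  sym : {M N : Matrix m n} → M ≈ N → N ≈ M
  sym p i j = R.sym (p i j)

  trans : {M N P : Matrix m n} → M ≈ N → N ≈ P → M ≈ P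
  trans p q i j = R.trans (p i j) (q i j)

  module ≈ᴹ-Reasoning {m n} = ≈-Reasoning (≈-setoid m n)
  open ≈ᴹ-Reasoning

  +-cong : {M M′ N N′ : Matrix m n} → M ≈ M′ → N ≈ N′ → M + N ≈ M′ + N′
  +-cong p q i j = R.+-cong (p i j) (q i j)

  +-identityˡ : (M : Matrix m n) → 0ᴹ + M ≈ M
  +-identityˡ M i j = R.+-identityˡ (M i j)

  +-identityʳ : (M : Matrix m n) → M + 0ᴹ ≈ M
  +-identityʳ M i j = R.+-identityʳ (M i j)

  +-comm : (M N : Matrix m n) → M + N ≈ N + M
  +-comm M N i j = R.+-comm (M i j) (N i j)

  +-isAbelianGroup : ∀ m n → IsAbelianGroup (_≈_ {m} {n}) _+_ 0ᴹ -_
  +-isAbelianGroup m n = record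
    { isGroup = record
      { isMonoid = record
        { isSemigroup = record
          { isMagma = record { isEquivalence = Setoid.isEquivalence (≈-setoid m n) ; ∙-cong = +-cong }
          ; assoc   = λ M N P i j → R.+-assoc (M i j) (N i j) (P i j) }
        ; identity = +-identityˡ , +-identityʳ }
      ; inverse = (λ M i j → R.-‿inverseˡ (M i j)) , (λ M i j → R.-‿inverseʳ (M i j))
      ; ⁻¹-cong = λ p i j → R.-‿cong (p i j) }
    ; comm = +-comm }

  +-isGroup : ∀ m n → IsGroup (_≈_ {m} {n}) _+_ 0ᴹ -_
  +-isGroup m n = IsAbelianGroup.isGroup (+-isAbelianGroup m n)

  +-cancel-idem : (M : Matrix m n) → M ≈ M + M → M ≈ 0ᴹ
  +-cancel-idem {m} {n} M M≈M+M = identityˡ-unique (record { isGroup = +-isGroup m n }) M M (sym M≈M+M)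

  *-cong : {M M′ : Matrix l m} {N N′ : Matrix m n} → M ≈ M′ → N ≈ N′ → M * N ≈ M′ * N′
  *-cong p q i k = sum-cong-≋ λ j → R.*-cong (p i j) (q j k)

  *-congˡ : (M : Matrix l m) {N N′ : Matrix m n} → N ≈ N′ → M * N ≈ M * N′
  *-congˡ M = *-cong (refl {M = M})

  *-congʳ : {M M′ : Matrix l m} (N : Matrix m n) → M ≈ M′ → M * N ≈ M′ * N
  *-congʳ N p = *-cong p (refl {M = N})

  *-assoc : (M : Matrix k l) (N : Matrix l m) (P : Matrix m n) → (M * N) * P ≈ M * (N * P)
  *-assoc {l = l} {m = m} M N P i j = ≈ᴿ.begin
    ∑[ b < m ] (∑[ a < l ] (M i a R.* N a b) R.* P b j)
      ≈ᴿ.≈⟨ sum-cong-≋ (λ b → *-distribʳ-sum (P b j) (λ a → M i a R.* N a b)) ⟩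
    ∑[ b < m ] ∑[ a < l ] ((M i a R.* N a b) R.* P b j)
      ≈ᴿ.≈⟨ ∑-comm (λ b a → (M i a R.* N a b) R.* P b j) ⟩
    ∑[ a < l ] ∑[ b < m ] ((M i a R.* N a b) R.* P b j)
      ≈ᴿ.≈⟨ sum-cong-≋ (λ a → sum-cong-≋ λ b → R.*-assoc (M i a) (N a b) (P b j)) ⟩
    ∑[ a < l ] ∑[ b < m ] (M i a R.* (N a b R.* P b j))
      ≈ᴿ.≈⟨ sum-cong-≋ (λ a → *-distribˡ-sum (M i a) (λ b → N a b R.* P b j)) ⟨
    ∑[ a < l ] (M i a R.* ∑[ b < m ] (N a b R.* P b j))     ≈ᴿ.∎

  *-distribˡ-+ : (M : Matrix l m) (N P : Matrix m n) → M * (N + P) ≈ M * N + M * P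
  *-distribˡ-+ M N P i k = R.trans (sum-cong-≋ λ j → R.distribˡ (M i j) (N j k) (P j k))
    (∑-distrib-+ (λ j → M i j R.* N j k) (λ j → M i j R.* P j k))

  *-distribʳ-+ : (P : Matrix m n) (M N : Matrix l m) → (M + N) * P ≈ M * P + N * P
  *-distribʳ-+ P M N i k = R.trans (sum-cong-≋ λ j → R.distribʳ (P j k) (M i j) (N i j))
    (∑-distrib-+ (λ j → M i j R.* P j k) (λ j → N i j R.* P j k))

  *-zeroˡ : (M : Matrix m n) → 0ᴹ {l} * M ≈ 0ᴹ
  *-zeroˡ {m = m} M i k = R.trans (sum-cong-≋ λ j → R.zeroˡ (M j k)) (sum-replicate-zero m)

  *-zeroʳ : (M : Matrix l m) → M * 0ᴹ {m} {n} ≈ 0ᴹ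
  *-zeroʳ {m = m} M i k = R.trans (sum-cong-≋ λ j → R.zeroʳ (M i j)) (sum-replicate-zero m)

  -‿distribˡ-* : (M : Matrix l m) (N : Matrix m n) → (- M) * N ≈ - (M * N)
  -‿distribˡ-* {l} {m} {n} M N = inverseˡ-unique (record { isGroup = +-isGroup l n }) _ _ (begin
    (- M) * N + M * N ≈⟨ *-distribʳ-+ N (- M) M ⟨
    ((- M) + M) * N   ≈⟨ *-congʳ N (IsGroup.inverseˡ (+-isGroup l m) M) ⟩
    0ᴹ * N            ≈⟨ *-zeroˡ N ⟩
    0ᴹ                ∎)

  -‿distribʳ-* : (M : Matrix l m) (N : Matrix m n) → M * (- N) ≈ - (M * N)
  -‿distribʳ-* {l} {m} {n} M N = inverseˡ-unique (record { isGroup = +-isGroup l n }) _ _ (begin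
    M * (- N) + M * N ≈⟨ *-distribˡ-+ M (- N) N ⟨
    M * ((- N) + N)   ≈⟨ *-congˡ M (IsGroup.inverseˡ (+-isGroup m n) N) ⟩
    M * 0ᴹ            ≈⟨ *-zeroʳ M ⟩
    0ᴹ                ∎)

  -- Used for `suc` in the identity laws and for the two inclusions of row indices in `I-split`.
  I-injective : {h : Fin m → Fin n} → (∀ {i j} → h i ≡ h j → i ≡ j) → ∀ i j → I (h i) (h j) ≡ I i j
  I-injective {h = h} h-injective i j with i Fin.≟ j | h i Fin.≟ h j
  ... | yes _   | yes _     = ≡.refl
  ... | yes i≡j | no  hi≢hj = contradiction (≡.cong h i≡j) hi≢hj
  ... | no  i≢j | yes hi≡hj = contradiction (h-injective hi≡hj) i≢j
  ... | no  _   | no  _     = ≡.refl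

  I-≢ : {i j : Fin n} → i ≡.≢ j → I i j ≡ R.0#
  I-≢ {i = i} {j = j} i≢j with i Fin.≟ j
  ... | yes i≡j = contradiction i≡j i≢j
  ... | no  _   = ≡.refl

  *-identityˡ : (M : Matrix m n) → I * M ≈ M
  *-identityˡ {m = suc m} M zero    k = ≈ᴿ.begin
    R.1# R.* M zero k R.+ ∑[ j < m ] (R.0# R.* M (suc j) k)
      -- The first row of `I` computes to a one followed by zeros, so the remaining sum is an entry
      -- of a zero matrix times the lower rows of `M`.
      ≈ᴿ.≈⟨ R.+-cong (R.*-identityˡ _) (*-zeroˡ {l = 1} (M ∘ suc) zero k) ⟩
    M zero k R.+ R.0#                                       ≈ᴿ.≈⟨ R.+-identityʳ _ ⟩
    M zero k                                                ≈ᴿ.∎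
  *-identityˡ {m = suc m} M (suc i) k = ≈ᴿ.begin
    R.0# R.* M zero k R.+ ∑[ j < m ] (I (suc i) (suc j) R.* M (suc j) k)
      ≈ᴿ.≈⟨ R.+-cong (R.zeroˡ _) (sum-cong-≋ λ j → R.*-congʳ (R.reflexive (I-injective Fin.suc-injective i j))) ⟩
    R.0# R.+ ∑[ j < m ] (I i j R.* M (suc j) k)                          ≈ᴿ.≈⟨ R.+-identityˡ _ ⟩
    ∑[ j < m ] (I i j R.* M (suc j) k)                                   ≈ᴿ.≈⟨ *-identityˡ (M ∘ suc) i k ⟩
    M (suc i) k                                                          ≈ᴿ.∎

  *-identityʳ : (M : Matrix m n) → M * I ≈ M
  *-identityʳ {n = suc n} M i zero    = ≈ᴿ.begin
    M i zero R.* R.1# R.+ ∑[ j < n ] (M i (suc j) R.* R.0#)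
      ≈ᴿ.≈⟨ R.+-cong (R.*-identityʳ _) (*-zeroʳ {n = 1} (λ i j → M i (suc j)) i zero) ⟩
    M i zero R.+ R.0#                                       ≈ᴿ.≈⟨ R.+-identityʳ _ ⟩
    M i zero                                                ≈ᴿ.∎
  *-identityʳ {n = suc n} M i (suc k) = ≈ᴿ.begin
    M i zero R.* R.0# R.+ ∑[ j < n ] (M i (suc j) R.* I (suc j) (suc k))
      ≈ᴿ.≈⟨ R.+-cong (R.zeroʳ _) (sum-cong-≋ λ j → R.*-congˡ (R.reflexive (I-injective Fin.suc-injective j k))) ⟩
    R.0# R.+ ∑[ j < n ] (M i (suc j) R.* I j k)                          ≈ᴿ.≈⟨ R.+-identityˡ _ ⟩
    ∑[ j < n ] (M i (suc j) R.* I j k)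
      ≈ᴿ.≈⟨ *-identityʳ (λ i j → M i (suc j)) i k ⟩
    M i (suc k)                                                          ≈ᴿ.∎

  matrixRing : ℕ → Ring c ℓ
  matrixRing n = record
    { isRing = record
      { +-isAbelianGroup = +-isAbelianGroup n n
      ; *-cong           = *-cong
      ; *-assoc          = *-assoc
      ; *-identity       = *-identityˡ , *-identityʳ
      ; distrib          = *-distribˡ-+ , *-distribʳ-+ } }

  -- Row and column blocks

  top : ∀ m {m′ n} → Matrix (m ℕ.+ m′) n → Matrix m n
  top m = Vector.take m

  bottom : ∀ m {m′ n} → Matrix (m ℕ.+ m′) n → Matrix m′ n
  bottom m = Vector.drop m

  left : ∀ n {m n′} → Matrix m (n ℕ.+ n′) → Matrix m n
  left n M i = Vector.take n (M i)

  right : ∀ n {m n′} → Matrix m (n ℕ.+ n′) → Matrix m n′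
  right n M i = Vector.drop n (M i)

  rows-≈ : ∀ m {M N : Matrix (m ℕ.+ m′) n} → top m M ≈ top m N → bottom m M ≈ bottom m N → M ≈ N
  rows-≈ {m′ = m′} m top≈ bottom≈ i j with splitAt m i in eq
  ... | inj₁ i′ rewrite ≡.sym (Fin.splitAt⁻¹-↑ˡ eq) = top≈ i′ j
  ... | inj₂ i′ rewrite ≡.sym (Fin.splitAt⁻¹-↑ʳ eq) = bottom≈ i′ j

  columns-≈ : ∀ n {M N : Matrix m (n ℕ.+ n′)} → left n M ≈ left n N → right n M ≈ right n N → M ≈ N
  columns-≈ n left≈ right≈ i j with splitAt n j in eq
  ... | inj₁ j′ rewrite ≡.sym (Fin.splitAt⁻¹-↑ˡ eq) = left≈ i j′
  ... | inj₂ j′ rewrite ≡.sym (Fin.splitAt⁻¹-↑ʳ eq) = right≈ i j′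

  top-⫽ : (M : Matrix m n) (N : Matrix m′ n) → top m (M ⫽ N) ≈ M
  top-⫽ M N i j = R.reflexive (≡.cong-app (lookup-++ˡ M N i) j)

  bottom-⫽ : (M : Matrix m n) (N : Matrix m′ n) → bottom m (M ⫽ N) ≈ N
  bottom-⫽ M N i j = R.reflexive (≡.cong-app (lookup-++ʳ M N i) j)

  left-∥ : (M : Matrix m n) (N : Matrix m n′) → left n (M ∥ N) ≈ M
  left-∥ M N i j = R.reflexive (lookup-++ˡ (M i) (N i) j)

  right-∥ : (M : Matrix m n) (N : Matrix m n′) → right n (M ∥ N) ≈ N
  right-∥ M N i j = R.reflexive (lookup-++ʳ (M i) (N i) j)

  top⫽bottom : ∀ m (M : Matrix (m ℕ.+ m′) n) → (top m M ⫽ bottom m M) ≈ M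
  top⫽bottom m M = rows-≈ m (top-⫽ _ _) (bottom-⫽ (top m M) _)

  left∥right : ∀ n (M : Matrix m (n ℕ.+ n′)) → left n M ∥ right n M ≈ M
  left∥right n M = columns-≈ n (left-∥ (left n M) (right n M)) (right-∥ (left n M) (right n M))

  ⫽-cong : {M M′ : Matrix m n} {N N′ : Matrix m′ n} → M ≈ M′ → N ≈ N′ → (M ⫽ N) ≈ (M′ ⫽ N′)
  ⫽-cong {m = m} p q i j with splitAt m i
  ... | inj₁ i′ = p i′ j
  ... | inj₂ i′ = q i′ j

  ∥-cong : {M M′ : Matrix m n} {N N′ : Matrix m n′} → M ≈ M′ → N ≈ N′ → M ∥ N ≈ M′ ∥ N′
  ∥-cong {n = n} p q i j with splitAt n j
  ... | inj₁ j′ = p i j′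
  ... | inj₂ j′ = q i j′

  ∥-congˡ : (M : Matrix m n) {N N′ : Matrix m n′} → N ≈ N′ → M ∥ N ≈ M ∥ N′
  ∥-congˡ M = ∥-cong (refl {M = M})

  ⫽-* : (M : Matrix m l) (N : Matrix m′ l) (P : Matrix l n) → (M ⫽ N) * P ≈ (M * P ⫽ N * P)
  ⫽-* {m = m} M N P i j with splitAt m i
  ... | inj₁ _ = R.refl
  ... | inj₂ _ = R.refl

  *-∥ : (M : Matrix m l) (N : Matrix l n) (P : Matrix l n′) → M * (N ∥ P) ≈ M * N ∥ M * P
  *-∥ {n = n} M N P i j with splitAt n j
  ... | inj₁ _ = R.refl
  ... | inj₂ _ = R.refl

  sum-split : ∀ m {n} (f : Vector R.Carrier (m ℕ.+ n)) →
              sum f R.≈ sum (Vector.take m f) R.+ sum (Vector.drop m f)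
  sum-split zero    f = R.sym (R.+-identityˡ _)
  sum-split (suc m) f = R.trans (R.+-congˡ (sum-split m (f ∘ suc))) (R.sym (R.+-assoc _ _ _))

  *-split : ∀ m (M : Matrix l (m ℕ.+ m′)) (N : Matrix (m ℕ.+ m′) n) →
            M * N ≈ left m M * top m N + right m M * bottom m N
  *-split m M N i k = sum-split m (λ j → M i j R.* N j k)

  ∥-*-⫽ : (M : Matrix l m) (N : Matrix l m′) (P : Matrix m n) (Q : Matrix m′ n) →
          (M ∥ N) * (P ⫽ Q) ≈ M * P + N * Q
  ∥-*-⫽ {m = m} M N P Q = trans (*-split m (M ∥ N) (P ⫽ Q))
    (+-cong (*-cong (left-∥ M N) (top-⫽ P Q)) (*-cong (right-∥ M N) (bottom-⫽ P Q)))

  -- `extension Φ Ψ δ a` unfolds to `lower (Φ a) (δ a) (Ψ a)`. The diagonal blocks may be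
  -- rectangular, so that g ⊕ I and I ⊕ f have this form too.
  lower : Matrix m n → Matrix m′ n → Matrix m′ n′ → Matrix (m ℕ.+ m′) (n ℕ.+ n′)
  lower P Q S = P ∥ 0ᴹ ⫽ Q ∥ S

  lower-cong : {P P′ : Matrix m n} {Q Q′ : Matrix m′ n} {S S′ : Matrix m′ n′} →
               P ≈ P′ → Q ≈ Q′ → S ≈ S′ → lower P Q S ≈ lower P′ Q′ S′
  lower-cong p q s = ⫽-cong (∥-cong p refl) (∥-cong q s)

  ∥-+ : (M M′ : Matrix m n) (N N′ : Matrix m n′) → (M ∥ N) + (M′ ∥ N′) ≈ M + M′ ∥ N + N′
  ∥-+ {n = n} M M′ N N′ i j with splitAt n j
  ... | inj₁ _ = R.refl
  ... | inj₂ _ = R.refl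

  ⫽-+ : (M M′ : Matrix m n) (N N′ : Matrix m′ n) → (M ⫽ N) + (M′ ⫽ N′) ≈ (M + M′ ⫽ N + N′)
  ⫽-+ {m = m} M M′ N N′ i j with splitAt m i
  ... | inj₁ _ = R.refl
  ... | inj₂ _ = R.refl

  lower-+ : (P P′ : Matrix m n) (Q Q′ : Matrix m′ n) (S S′ : Matrix m′ n′) →
            lower P Q S + lower P′ Q′ S′ ≈ lower (P + P′) (Q + Q′) (S + S′)
  lower-+ P P′ Q Q′ S S′ = trans (⫽-+ (P ∥ 0ᴹ) (P′ ∥ 0ᴹ) (Q ∥ S) (Q′ ∥ S′))
    (⫽-cong (trans (∥-+ P P′ 0ᴹ 0ᴹ) (∥-congˡ (P + P′) (+-identityˡ 0ᴹ))) (∥-+ Q Q′ S S′))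

  -- `h` has to fix 0 for the sake of the upper right block. It is applied to negation and to
  -- multiplication by a scalar.
  lower-map : (h : R.Carrier → R.Carrier) → h R.0# R.≈ R.0# →
              (P : Matrix m n) (Q : Matrix m′ n) (S : Matrix m′ n′) →
              (λ i j → h (lower P Q S i j)) ≈
              lower (λ i j → h (P i j)) (λ i j → h (Q i j)) (λ i j → h (S i j))
  lower-map {m = m} h h0≈0 P Q S i j with splitAt m i
  lower-map {n = n} h h0≈0 P Q S i j | inj₁ _ with splitAt n j
  ... | inj₁ _ = R.refl
  ... | inj₂ _ = h0≈0
  lower-map {n = n} h h0≈0 P Q S i j | inj₂ _ with splitAt n j
  ... | inj₁ _ = R.refl
  ... | inj₂ _ = R.refl

  0∥0 : 0ᴹ {m} {n} ∥ 0ᴹ {m} {n′} ≈ 0ᴹ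
  0∥0 {n = n} i j with splitAt n j
  ... | inj₁ _ = R.refl
  ... | inj₂ _ = R.refl

  0⫽0 : (0ᴹ {m} {n} ⫽ 0ᴹ {m′} {n}) ≈ 0ᴹ
  0⫽0 {m = m} i j with splitAt m i
  ... | inj₁ _ = R.refl
  ... | inj₂ _ = R.refl

  lower-0 : lower (0ᴹ {m} {n}) (0ᴹ {m′}) (0ᴹ {m′} {n′}) ≈ 0ᴹ
  lower-0 {m = m} {n = n} = trans (⫽-cong {m = m} (0∥0 {n = n}) (0∥0 {n = n})) (0⫽0 {m = m})

  -- Diagonal blocks are compared by `I-injective`. In an off-diagonal block, i = j would identify
  -- an `inj₁` with an `inj₂`.
  I-split : ∀ m (i j : Fin (m ℕ.+ n)) → lower (I {m}) 0ᴹ (I {n}) i j ≡ I i j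
  I-split m i j with splitAt m i in i≡
  I-split {n} m i j | inj₁ i′ with splitAt m j in j≡
  ... | inj₁ j′ rewrite ≡.sym (Fin.splitAt⁻¹-↑ˡ i≡) | ≡.sym (Fin.splitAt⁻¹-↑ˡ j≡) =
    ≡.sym (I-injective {h = _↑ˡ n} (Fin.↑ˡ-injective n _ _) i′ j′)
  ... | inj₂ _ = ≡.sym (I-≢ λ i≡j → case ≡.trans (≡.sym i≡) (≡.trans (≡.cong (splitAt m) i≡j) j≡) of λ ())
  I-split m i j | inj₂ _ with splitAt m j in j≡
  ... | inj₁ _ = ≡.sym (I-≢ λ i≡j → case ≡.trans (≡.sym i≡) (≡.trans (≡.cong (splitAt m) i≡j) j≡) of λ ())
  ... | inj₂ _ rewrite ≡.sym (Fin.splitAt⁻¹-↑ʳ i≡) | ≡.sym (Fin.splitAt⁻¹-↑ʳ j≡) =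
    ≡.sym (I-injective {h = m ↑ʳ_} (Fin.↑ʳ-injective m _ _) _ _)

  lower-I : lower (I {m}) 0ᴹ (I {n}) ≈ I
  lower-I {m = m} i j = R.reflexive (I-split m i j)

  lower-*-⫽ : (P : Matrix m n) (Q : Matrix m′ n) (S : Matrix m′ n′) (M : Matrix n k) (N : Matrix n′ k) →
              lower P Q S * (M ⫽ N) ≈ (P * M ⫽ Q * M + S * N)
  lower-*-⫽ P Q S M N = begin
    (P ∥ 0ᴹ ⫽ Q ∥ S) * (M ⫽ N)                    ≈⟨ ⫽-* (P ∥ 0ᴹ) (Q ∥ S) (M ⫽ N) ⟩
    ((P ∥ 0ᴹ) * (M ⫽ N) ⫽ (Q ∥ S) * (M ⫽ N))      ≈⟨ ⫽-cong (∥-*-⫽ P 0ᴹ M N) (∥-*-⫽ Q S M N) ⟩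
    (P * M + 0ᴹ * N ⫽ Q * M + S * N)
      ≈⟨ ⫽-cong (trans (+-cong refl (*-zeroˡ N)) (+-identityʳ (P * M))) refl ⟩
    (P * M ⫽ Q * M + S * N)                       ∎

  ∥-*-lower : (M : Matrix k m) (N : Matrix k m′) (P : Matrix m n) (Q : Matrix m′ n) (S : Matrix m′ n′) →
              (M ∥ N) * lower P Q S ≈ M * P + N * Q ∥ N * S
  ∥-*-lower M N P Q S = begin
    (M ∥ N) * (P ∥ 0ᴹ ⫽ Q ∥ S)                    ≈⟨ ∥-*-⫽ M N (P ∥ 0ᴹ) (Q ∥ S) ⟩
    M * (P ∥ 0ᴹ) + N * (Q ∥ S)                    ≈⟨ +-cong (*-∥ M P 0ᴹ) (*-∥ N Q S) ⟩
    (M * P ∥ M * 0ᴹ) + (N * Q ∥ N * S)            ≈⟨ ∥-+ (M * P) (N * Q) (M * 0ᴹ) (N * S) ⟩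
    M * P + N * Q ∥ M * 0ᴹ + N * S
      ≈⟨ ∥-congˡ (M * P + N * Q) (trans (+-cong (*-zeroʳ M) refl) (+-identityˡ (N * S))) ⟩
    M * P + N * Q ∥ N * S                         ∎

  -- For the blocks of an extension the lower left block reads δ(a) Φ_b + Ψ_a δ(b): multiplicativity
  -- of `X` is the Leibniz rule.
  lower-* : (P : Matrix l m) (Q : Matrix k m) (S : Matrix k m′)
            (P′ : Matrix m n) (Q′ : Matrix m′ n) (S′ : Matrix m′ n′) →
            lower P Q S * lower P′ Q′ S′ ≈ lower (P * P′) (Q * P′ + S * Q′) (S * S′)
  lower-* P Q S P′ Q′ S′ = begin
    lower P Q S * (P′ ∥ 0ᴹ ⫽ Q′ ∥ S′)                             ≈⟨ lower-*-⫽ P Q S (P′ ∥ 0ᴹ) (Q′ ∥ S′) ⟩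
    (P * (P′ ∥ 0ᴹ) ⫽ Q * (P′ ∥ 0ᴹ) + S * (Q′ ∥ S′))
      ≈⟨ ⫽-cong (*-∥ P P′ 0ᴹ) (+-cong (*-∥ Q P′ 0ᴹ) (*-∥ S Q′ S′)) ⟩
    (P * P′ ∥ P * 0ᴹ ⫽ (Q * P′ ∥ Q * 0ᴹ) + (S * Q′ ∥ S * S′))
      ≈⟨ ⫽-cong (∥-congˡ (P * P′) (*-zeroʳ P)) (∥-+ (Q * P′) (S * Q′) (Q * 0ᴹ) (S * S′)) ⟩
    (P * P′ ∥ 0ᴹ ⫽ Q * P′ + S * Q′ ∥ Q * 0ᴹ + S * S′)
      ≈⟨ lower-cong {P = P * P′} {Q = Q * P′ + S * Q′} refl refl (trans (+-cong (*-zeroʳ Q) refl) (+-identityˡ (S * S′))) ⟩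
    lower (P * P′) (Q * P′ + S * Q′) (S * S′)                     ∎

  0⫽I-* : ∀ m (M : Matrix m′ n) → (0ᴹ {m} ⫽ I) * M ≈ (0ᴹ {m} ⫽ M)
  0⫽I-* m M = trans (⫽-* (0ᴹ {m}) I M) (⫽-cong (*-zeroˡ M) (*-identityˡ M))

  -- Composing with `i` selects a block, as composing with `π` does in `I∥0-*`. Conditions such as
  -- `h * i ≈ 0ᴹ` thus become the vanishing of one block.
  *-0⫽I : ∀ n (M : Matrix m (n ℕ.+ n′)) → M * (0ᴹ {n} ⫽ I) ≈ right n M
  *-0⫽I n M = begin
    M * (0ᴹ {n} ⫽ I)              ≈⟨ *-congʳ (0ᴹ {n} ⫽ I) (left∥right n M) ⟨
    (left n M ∥ right n M) * (0ᴹ ⫽ I)  ≈⟨ ∥-*-⫽ (left n M) (right n M) 0ᴹ I ⟩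
    left n M * 0ᴹ + right n M * I ≈⟨ +-cong (*-zeroʳ (left n M)) (*-identityʳ (right n M)) ⟩
    0ᴹ + right n M                ≈⟨ +-identityˡ (right n M) ⟩
    right n M                     ∎

  I∥0-* : ∀ m (M : Matrix (m ℕ.+ m′) n) → (I {m} ∥ 0ᴹ) * M ≈ top m M
  I∥0-* m M = begin
    (I {m} ∥ 0ᴹ) * M                     ≈⟨ *-congˡ (I ∥ 0ᴹ) (top⫽bottom m M) ⟨
    (I {m} ∥ 0ᴹ) * (top m M ⫽ bottom m M) ≈⟨ ∥-*-⫽ I 0ᴹ (top m M) (bottom m M) ⟩
    I * top m M + 0ᴹ * bottom m M        ≈⟨ +-cong (*-identityˡ (top m M)) (*-zeroˡ (bottom m M)) ⟩
    top m M + 0ᴹ                         ≈⟨ +-identityʳ (top m M) ⟩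
    top m M                              ∎

  *-I∥0 : (M : Matrix m n) → M * (I ∥ 0ᴹ {n} {n′}) ≈ M ∥ 0ᴹ
  *-I∥0 M = trans (*-∥ M I 0ᴹ) (∥-cong (*-identityʳ M) (*-zeroʳ M))

  module _ (P : Matrix m n) (Q : Matrix m′ n) (S : Matrix m′ n′) where

    lower-*-0⫽I : lower P Q S * (0ᴹ {n} ⫽ I) ≈ (0ᴹ {m} ⫽ S)
    lower-*-0⫽I = begin
      lower P Q S * (0ᴹ {n} ⫽ I)    ≈⟨ lower-*-⫽ P Q S (0ᴹ {n}) I ⟩
      (P * 0ᴹ ⫽ Q * 0ᴹ + S * I)     ≈⟨ ⫽-cong (*-zeroʳ P) (+-cong (*-zeroʳ Q) (*-identityʳ S)) ⟩
      (0ᴹ ⫽ 0ᴹ + S)                 ≈⟨ ⫽-cong (refl {M = 0ᴹ}) (+-identityˡ S) ⟩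
      (0ᴹ ⫽ S)                      ∎

    I∥0-*-lower : (I {m} ∥ 0ᴹ) * lower P Q S ≈ P ∥ 0ᴹ
    I∥0-*-lower = trans (I∥0-* m (lower P Q S)) (top-⫽ (P ∥ 0ᴹ) (Q ∥ S))

    lower-*-split : (M : Matrix (n ℕ.+ n′) k) →
                    lower P Q S * M ≈ (P * top n M ⫽ Q * top n M + S * bottom n M)
    lower-*-split M = trans (*-congˡ (lower P Q S) (sym (top⫽bottom n M)))
      (lower-*-⫽ P Q S (top n M) (bottom n M))

    bottom-lower-* : (M : Matrix (n ℕ.+ n′) k) →
                     bottom m (lower P Q S * M) ≈ Q * top n M + S * bottom n M
    bottom-lower-* M = trans (λ i → lower-*-split M (m ↑ʳ i)) (bottom-⫽ (P * top n M) _)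

    *-lower-split : (M : Matrix k (m ℕ.+ m′)) →
                    M * lower P Q S ≈ left m M * P + right m M * Q ∥ right m M * S
    *-lower-split M = trans (*-congʳ (lower P Q S) (sym (left∥right m M)))
      (∥-*-lower (left m M) (right m M) P Q S)

    left-*-lower : (M : Matrix k (m ℕ.+ m′)) →
                   left n (M * lower P Q S) ≈ left m M * P + right m M * Q
    left-*-lower M = trans (λ i j → *-lower-split M i (j ↑ˡ n′)) (left-∥ (left m M * P + right m M * Q) _)

  -- If P ^ n = S ^ n = 0, then the n-th power is [ 0 0 ; Q′ 0 ], whose square is 0.
  lower-nilpotent : (P : Matrix m m) (Q : Matrix n m) (S : Matrix n n) →
                    IsNilpotent P → IsNilpotent S → IsNilpotent (lower P Q S)
  lower-nilpotent {m = m} {n = n} P Q S (a , Pᵃ≈0) (b , Sᵇ≈0) = (a ℕ.+ b) ℕ.+ (a ℕ.+ b) , (begin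
    lower P Q S L.^ ((a ℕ.+ b) ℕ.+ (a ℕ.+ b))         ≈⟨ L.^-homo-* (lower P Q S) (a ℕ.+ b) (a ℕ.+ b) ⟩
    lower P Q S L.^ (a ℕ.+ b) * lower P Q S L.^ (a ℕ.+ b)  ≈⟨ *-cong power≈ power≈ ⟩
    lower 0ᴹ Q′ 0ᴹ * lower 0ᴹ Q′ 0ᴹ                   ≈⟨ lower-* 0ᴹ Q′ 0ᴹ 0ᴹ Q′ 0ᴹ ⟩
    lower (0ᴹ {m} * 0ᴹ {m}) (Q′ * 0ᴹ {m} + 0ᴹ {n} * Q′) (0ᴹ {n} * 0ᴹ {n})
      ≈⟨ lower-cong {m = m} {n = m} (*-zeroˡ (0ᴹ {m} {m}))
          (trans (+-cong (*-zeroʳ Q′) (*-zeroˡ Q′)) (+-identityˡ 0ᴹ)) (*-zeroˡ (0ᴹ {n} {n})) ⟩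
    lower (0ᴹ {m} {m}) (0ᴹ {n} {m}) (0ᴹ {n} {n})      ≈⟨ lower-0 {m = m} {n = m} ⟩
    0ᴹ                                                ∎)
    where
    module L = Exp (Ring.semiring (matrixRing (m ℕ.+ n)))
    module P = Exp (Ring.semiring (matrixRing m))
    module S = Exp (Ring.semiring (matrixRing n))

    -- The recursion is read off from `lower-*`; squaring kills this block whatever its value.
    corner : ℕ → Matrix n m
    corner zero    = 0ᴹ
    corner (suc k) = Q * P P.^ k + S * corner k

    power : ∀ k → lower P Q S L.^ k ≈ lower (P P.^ k) (corner k) (S S.^ k)
    power zero    = sym (lower-I {m = m})
    power (suc k) = trans (*-congˡ (lower P Q S) (power k)) (lower-* P Q S (P P.^ k) (corner k) (S S.^ k))

    -- The sum is a common exponent for both diagonal blocks: it splits off P^a in one and S^b in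
    -- the other.
    Q′ = corner (a ℕ.+ b)

    power≈ : lower P Q S L.^ (a ℕ.+ b) ≈ lower 0ᴹ Q′ 0ᴹ
    power≈ = trans (power (a ℕ.+ b)) (lower-cong
      (trans (P.^-homo-* P a b) (trans (*-congʳ (P P.^ b) Pᵃ≈0) (*-zeroˡ (P P.^ b))))
      refl
      (trans (S.^-homo-* S a b) (trans (*-congˡ (S S.^ a) Sᵇ≈0) (*-zeroʳ (S S.^ a)))))

-- 𝐭-modules

module TModuleProperties (B : BaseData c₁ ℓ₁ a₁ c₂ ℓ₂ a₂) where

  open TModules B

  private
    F-ring : CommutativeRing c₁ ℓ₁
    F-ring = fieldRing F

    K-ring : CommutativeRing c₂ ℓ₂
    K-ring = fieldRing K

    module Kᶜ = CommutativeRing K-ring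
    module Fᶜ = CommutativeRing F-ring
    module F→K = IsRingHomomorphism F→K-isHom

  module K⟨τ⟩-Properties = SkewPolynomialProperties (fieldRawRing K) Kᶜ.isRing
    (Frobenius.frobenius-isSemiringHomomorphism K-ring p-prime K-char m q≡pᵐ)
  -- 𝔽_q[t] is the skew polynomial ring with trivial twist, so the same laws serve for `A`.
  module A-Properties = SkewPolynomialProperties (fieldRawRing F) Fᶜ.isRing
    (Identity.isSemiringHomomorphism (RawRing.rawSemiring (fieldRawRing F)) Fᶜ.refl)
  private
    module K⟨τ⟩ₚ = K⟨τ⟩-Properties
    module MatKₚ = MatrixProperties (fieldRawRing K) Kᶜ.isRing
  open MatrixProperties K⟨τ⟩.rawRing K⟨τ⟩ₚ.skew-isRing
  open ≈ᴹ-Reasoning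

  private
    K⟨τ⟩-ring : Ring c₂ ℓ₂
    K⟨τ⟩-ring = record { isRing = K⟨τ⟩ₚ.skew-isRing }
    module K⟨τ⟩ᴿ = Ring K⟨τ⟩-ring
  open import Algebra.Properties.Semiring.Sum K⟨τ⟩ᴿ.semiring using (sum; sum-cong-≋)
  open import Algebra.Properties.Semiring.Exp Kᶜ.semiring using (_^_; ^-congˡ)
  open import Algebra.Properties.Semiring.Exp Fᶜ.semiring using () renaming (_^_ to _^ᶠ_)

  private variable
    d e k l n m′ n′ r : ℕ

  F→K-^ : ∀ a n → F→K (a ^ᶠ n) K.≈ F→K a ^ n
  F→K-^ a zero    = F→K.1#-homo
  F→K-^ a (suc n) = K.trans (F→K.*-homo a (a ^ᶠ n)) (K.*-cong K.refl (F→K-^ a n))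

  -- The relation is proved in `F`, where elements can be enumerated, and carried to `K` by the ring
  -- map.
  F→K-fixed : ∀ a → F→K a ^ q K.≈ F→K a
  F→K-fixed a = K.trans (K.sym (F→K-^ a q)) (F→K.⟦⟧-cong (FiniteField.x^q≈x F F-finite a))

  ·-sum : ∀ a {n} (f : Fin n → K⟨τ⟩.Poly) → a K⟨τ⟩.· sum f K⟨τ⟩.≈ sum (λ i → a K⟨τ⟩.· f i)
  ·-sum a {zero}  f = K⟨τ⟩ᴿ.refl
  ·-sum a {suc n} f = K⟨τ⟩ᴿ.trans (K⟨τ⟩ₚ.·-distribˡ-+ a (f zero) (sum (f ∘ suc)))
    (K⟨τ⟩ₚ.+-congˡ {a K⟨τ⟩.· f zero} (·-sum a (f ∘ suc)))

  •-cong : ∀ a {M N : Matrix k n} → M ≈ N → a • M ≈ a • N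
  •-cong a p i j = K⟨τ⟩ₚ.·-cong K.refl (p i j)

  •-*-assoc : ∀ a (M : Matrix k l) (N : Matrix l n) → (a • M) * N ≈ a • (M * N)
  •-*-assoc a M N i k = K⟨τ⟩ᴿ.trans
    (sum-cong-≋ λ j → K⟨τ⟩ₚ.·-*-assoc (F→K a) (M i j) (N j k))
    (K⟨τ⟩ᴿ.sym (·-sum (F→K a) λ j → M i j K⟨τ⟩.* N j k))

  -- The scalars from F are central because F is fixed by the Frobenius map.
  *-•-comm : ∀ a (M : Matrix k l) (N : Matrix l n) → M * (a • N) ≈ a • (M * N)
  *-•-comm a M N i k = K⟨τ⟩ᴿ.trans
    (sum-cong-≋ λ j → K⟨τ⟩ₚ.*-·-comm K.*-comm (F→K-fixed a) (M i j) (N j k))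
    (K⟨τ⟩ᴿ.sym (·-sum (F→K a) λ j → M i j K⟨τ⟩.* N j k))

  A∷-homo : {Φ : Family d} → IsTModule Φ → ∀ a b → Φ (a ∷ b) ≈ a • I + Φ t * Φ b
  A∷-homo {Φ = Φ} Φ-isTModule a b = begin
    -- Multiplication by `t` applies the trivial twist to every coefficient, so the tail is first
    -- put into the form `List.map id b`.
    Φ (a ∷ b)                                ≡⟨ ≡.cong (λ b → Φ (a ∷ b)) (map-id b) ⟨
    Φ (a ∷ List.map id b)                    ≈⟨ ⟦⟧-cong (A-Properties.a∷σf≈a·1+τf a b) ⟩
    Φ (a A.• A.1# A.+ t A.* b)               ≈⟨ +-homo (a A.• A.1#) (t A.* b) ⟩
    Φ (a A.• A.1#) + Φ (t A.* b)             ≈⟨ +-cong (•-homo a A.1#) (*-homo t b) ⟩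
    a • Φ A.1# + Φ t * Φ b                   ≈⟨ +-cong (•-cong a 1#-homo) refl ⟩
    a • I + Φ t * Φ b                        ∎
    where open IsAlgebraHomomorphism (IsTModule.isAlgebraHomomorphism Φ-isTModule)

  -- Induction along Horner's scheme a + t b, which is the list structure: `f` passes the scalar by
  -- centrality, the action of `t` by hypothesis and that of `b` by induction.
  morphism-commutes : {Ψ : Family e} {Φ : Family d} {f : Matrix d e} → IsTModule Ψ → IsTModule Φ →
                      IsMorphism Ψ Φ f → ∀ a → f * Ψ a ≈ Φ a * f
  morphism-commutes {Ψ = Ψ} {Φ = Φ} {f = f} Ψ-isTModule Φ-isTModule fΨₜ≈Φₜf = go
    where
    module Φ = IsAlgebraHomomorphism (IsTModule.isAlgebraHomomorphism Φ-isTModule)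
    module Ψ = IsAlgebraHomomorphism (IsTModule.isAlgebraHomomorphism Ψ-isTModule)

    go : ∀ a → f * Ψ a ≈ Φ a * f
    go []      = begin
      f * Ψ []                       ≈⟨ *-congˡ f Ψ.0#-homo ⟩
      f * 0ᴹ                         ≈⟨ *-zeroʳ f ⟩
      0ᴹ                             ≈⟨ *-zeroˡ f ⟨
      0ᴹ * f                         ≈⟨ *-congʳ f Φ.0#-homo ⟨
      Φ [] * f                       ∎
    go (a ∷ b) = begin
      f * Ψ (a ∷ b)                  ≈⟨ *-congˡ f (A∷-homo Ψ-isTModule a b) ⟩
      f * (a • I + Ψ t * Ψ b)        ≈⟨ *-distribˡ-+ f (a • I) (Ψ t * Ψ b) ⟩
      f * (a • I) + f * (Ψ t * Ψ b)  ≈⟨ +-cong scalar linear ⟩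
      (a • I) * f + (Φ t * Φ b) * f  ≈⟨ *-distribʳ-+ f (a • I) (Φ t * Φ b) ⟨
      (a • I + Φ t * Φ b) * f        ≈⟨ *-congʳ f (A∷-homo Φ-isTModule a b) ⟨
      Φ (a ∷ b) * f                  ∎
      where
      scalar : f * (a • I) ≈ (a • I) * f
      scalar = begin
        f * (a • I)         ≈⟨ *-•-comm a f I ⟩
        a • (f * I)         ≈⟨ •-cong a (trans (*-identityʳ f) (sym (*-identityˡ f))) ⟩
        a • (I * f)         ≈⟨ •-*-assoc a I f ⟨
        (a • I) * f         ∎
      linear : f * (Ψ t * Ψ b) ≈ (Φ t * Φ b) * f
      linear = begin
        f * (Ψ t * Ψ b)     ≈⟨ *-assoc f (Ψ t) (Ψ b) ⟨
        (f * Ψ t) * Ψ b     ≈⟨ *-congʳ (Ψ b) fΨₜ≈Φₜf ⟩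
        (Φ t * f) * Ψ b     ≈⟨ *-assoc (Φ t) f (Ψ b) ⟩
        Φ t * (f * Ψ b)     ≈⟨ *-congˡ (Φ t) (go b) ⟩
        Φ t * (Φ b * f)     ≈⟨ *-assoc (Φ t) (Φ b) f ⟨
        (Φ t * Φ b) * f     ∎

  module _ {Φ : Family d} {Ψ : Family e} {δ : A.Carrier → Matrix e d} (δ-isBiderivation : IsBiderivation Φ Ψ δ) where

    open IsBiderivation δ-isBiderivation
    private module δ = LeftModuleMorphisms.IsLeftModuleHomomorphism linear

    -- Commutation is asked at every element of `A`, because in the Leibniz rule `g` has to cross
    -- Φ_b for an arbitrary second argument.
    *-isBiderivation : {Ξ : Family r} {g : Matrix d r} → (∀ a → g * Ξ a ≈ Φ a * g) →
                       IsBiderivation Ξ Ψ (λ a → δ a * g)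
    *-isBiderivation {Ξ = Ξ} {g = g} gΞ≈Φg = record
      { linear = record
        { +ᴹ-isGroupHomomorphism = record
          { isMonoidHomomorphism = record
            { isMagmaHomomorphism = record
              { isRelHomomorphism = record { cong = λ a≈b → *-congʳ g (δ.⟦⟧-cong a≈b) }
              ; homo = λ a b → trans (*-congʳ g (δ.+ᴹ-homo a b)) (*-distribʳ-+ g (δ a) (δ b)) }
            ; ε-homo = trans (*-congʳ g δ.0ᴹ-homo) (*-zeroˡ g) }
          ; ⁻¹-homo = λ a → trans (*-congʳ g (δ.-ᴹ-homo a)) (-‿distribˡ-* (δ a) g) }
        ; *ₗ-homo = λ c a → trans (*-congʳ g (δ.*ₗ-homo c a)) (•-*-assoc c (δ a) g) }
      ; leibniz = λ a b → begin
          δ (a A.* b) * g                        ≈⟨ *-congʳ g (leibniz a b) ⟩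
          (Ψ a * δ b + δ a * Φ b) * g            ≈⟨ *-distribʳ-+ g (Ψ a * δ b) (δ a * Φ b) ⟩
          (Ψ a * δ b) * g + (δ a * Φ b) * g      ≈⟨ +-cong (*-assoc (Ψ a) (δ b) g) (*-assoc (δ a) (Φ b) g) ⟩
          Ψ a * (δ b * g) + δ a * (Φ b * g)      ≈⟨ +-cong refl (*-congˡ (δ a) (gΞ≈Φg b)) ⟨
          Ψ a * (δ b * g) + δ a * (g * Ξ b)      ≈⟨ +-cong refl (*-assoc (δ a) g (Ξ b)) ⟨
          Ψ a * (δ b * g) + (δ a * g) * Ξ b      ∎ }

    -- Here `f` has to cross Ψ_a for an arbitrary first argument. Linearity also moves a scalar from
    -- the right of `f` to its left, which is a second use of centrality.
    isBiderivation-* : {Ξ : Family r} {f : Matrix r e} → (∀ a → f * Ψ a ≈ Ξ a * f) →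
                       IsBiderivation Φ Ξ (λ a → f * δ a)
    isBiderivation-* {Ξ = Ξ} {f = f} fΨ≈Ξf = record
      { linear = record
        { +ᴹ-isGroupHomomorphism = record
          { isMonoidHomomorphism = record
            { isMagmaHomomorphism = record
              { isRelHomomorphism = record { cong = λ a≈b → *-congˡ f (δ.⟦⟧-cong a≈b) }
              ; homo = λ a b → trans (*-congˡ f (δ.+ᴹ-homo a b)) (*-distribˡ-+ f (δ a) (δ b)) }
            ; ε-homo = trans (*-congˡ f δ.0ᴹ-homo) (*-zeroʳ f) }
          ; ⁻¹-homo = λ a → trans (*-congˡ f (δ.-ᴹ-homo a)) (-‿distribʳ-* f (δ a)) }
        ; *ₗ-homo = λ c a → trans (*-congˡ f (δ.*ₗ-homo c a)) (*-•-comm c f (δ a)) }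
      ; leibniz = λ a b → begin
          f * δ (a A.* b)                        ≈⟨ *-congˡ f (leibniz a b) ⟩
          f * (Ψ a * δ b + δ a * Φ b)            ≈⟨ *-distribˡ-+ f (Ψ a * δ b) (δ a * Φ b) ⟩
          f * (Ψ a * δ b) + f * (δ a * Φ b)      ≈⟨ +-cong (*-assoc f (Ψ a) (δ b)) (*-assoc f (δ a) (Φ b)) ⟨
          (f * Ψ a) * δ b + (f * δ a) * Φ b      ≈⟨ +-cong (*-congʳ (δ b) (fΨ≈Ξf a)) refl ⟩
          (Ξ a * f) * δ b + (f * δ a) * Φ b      ≈⟨ +-cong (*-assoc (Ξ a) f (δ b)) refl ⟩
          Ξ a * (f * δ b) + (f * δ a) * Φ b      ∎ }

  -- `lower-map` concerns maps of one ring to itself, while `∂` leads from K{τ} to `K`; the zero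
  -- block is preserved because the constant coefficient of `[]` computes to 0.
  ∂-lower : (P : Matrix k n) (Q : Matrix m′ n) (S : Matrix m′ n′) →
            ∂ (lower P Q S) MatK.≈ MatKₚ.lower (∂ P) (∂ Q) (∂ S)
  ∂-lower {k = k} P Q S i j with splitAt k i
  ∂-lower {n = n} P Q S i j | inj₁ _ with splitAt n j
  ... | inj₁ _ = K.refl
  ... | inj₂ _ = K.refl
  ∂-lower {n = n} P Q S i j | inj₂ _ with splitAt n j
  ... | inj₁ _ = K.refl
  ... | inj₂ _ = K.refl

  -- The short exact sequence of a biderivation

  module Extension {Φ : Family d} {Ψ : Family e} (Φ-isTModule : IsTModule Φ) (Ψ-isTModule : IsTModule Ψ)
    {δ : A.Carrier → Matrix e d} (δ-isBiderivation : IsBiderivation Φ Ψ δ) where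

    private
      module Φ where
        open IsTModule Φ-isTModule public
        open IsAlgebraHomomorphism isAlgebraHomomorphism public
      module Ψ where
        open IsTModule Ψ-isTModule public
        open IsAlgebraHomomorphism isAlgebraHomomorphism public
      open IsBiderivation δ-isBiderivation
      module δ = LeftModuleMorphisms.IsLeftModuleHomomorphism linear

    X : Family (d ℕ.+ e)
    X = extension Φ Ψ δ

    i : Matrix (d ℕ.+ e) e
    i = 0ᴹ {d} {e} ⫽ I {e}

    π : Matrix d (d ℕ.+ e)
    π = I {d} ∥ 0ᴹ {d} {e}

    -- Leibniz at 1 · 1 reads δ(1) = δ(1) + δ(1). This makes `X` send 1 to the identity matrix.
    δ1≈0 : δ A.1# ≈ 0ᴹ
    δ1≈0 = +-cancel-idem (δ A.1#) (begin
      δ A.1#                              ≈⟨ δ.⟦⟧-cong (A-Properties.*-identityˡ A.1#) ⟨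
      δ (A.1# A.* A.1#)                   ≈⟨ leibniz A.1# A.1# ⟩
      Ψ A.1# * δ A.1# + δ A.1# * Φ A.1#
        ≈⟨ +-cong (*-congʳ (δ A.1#) Ψ.1#-homo) (*-congˡ (δ A.1#) Φ.1#-homo) ⟩
      I * δ A.1# + δ A.1# * I             ≈⟨ +-cong (*-identityˡ (δ A.1#)) (*-identityʳ (δ A.1#)) ⟩
      δ A.1# + δ A.1#                     ∎)

    X-isAlgebraHomomorphism : IsAlgebraHomomorphism A-algebra (matrixAlgebra (d ℕ.+ e)) X
    X-isAlgebraHomomorphism = record
      { isRingHomomorphism = record
        { isSemiringHomomorphism = record
          { isNearSemiringHomomorphism = record
            { +-isMonoidHomomorphism = record
              { isMagmaHomomorphism = record
                { isRelHomomorphism = record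
                  { cong = λ a≈b → lower-cong (Φ.⟦⟧-cong a≈b) (δ.⟦⟧-cong a≈b) (Ψ.⟦⟧-cong a≈b) }
                ; homo = λ a b → trans
                    (lower-cong (Φ.+-homo a b) (δ.+ᴹ-homo a b) (Ψ.+-homo a b))
                    (sym (lower-+ (Φ a) (Φ b) (δ a) (δ b) (Ψ a) (Ψ b))) }
              ; ε-homo = trans (lower-cong Φ.0#-homo δ.0ᴹ-homo Ψ.0#-homo) (lower-0 {m = d} {n = d}) }
            ; *-homo = λ a b → begin
                lower (Φ (a A.* b)) (δ (a A.* b)) (Ψ (a A.* b))
                  ≈⟨ lower-cong (Φ.*-homo a b) (δ-* a b) (Ψ.*-homo a b) ⟩
                lower (Φ a * Φ b) (δ a * Φ b + Ψ a * δ b) (Ψ a * Ψ b)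
                  ≈⟨ lower-* (Φ a) (δ a) (Ψ a) (Φ b) (δ b) (Ψ b) ⟨
                X a * X b ∎ }
          ; 1#-homo = trans (lower-cong Φ.1#-homo δ1≈0 Ψ.1#-homo) (lower-I {m = d}) }
        ; -‿homo = λ a → trans (lower-cong (Φ.-‿homo a) (δ.-ᴹ-homo a) (Ψ.-‿homo a))
            (sym (lower-map (RawRing.-_ K⟨τ⟩.rawRing) K⟨τ⟩ᴿ.refl (Φ a) (δ a) (Ψ a))) }
      ; •-homo = λ c a → trans (lower-cong (Φ.•-homo c a) (δ.*ₗ-homo c a) (Ψ.•-homo c a))
          (sym (lower-map (F→K c K⟨τ⟩.·_) K⟨τ⟩ᴿ.refl (Φ a) (δ a) (Ψ a))) }
      where
      δ-* : ∀ a b → δ (a A.* b) ≈ δ a * Φ b + Ψ a * δ b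
      δ-* a b = trans (leibniz a b) (+-comm (Ψ a * δ b) (δ a * Φ b))

    X-isTModule : IsTModule X
    X-isTModule = record
      { isAlgebraHomomorphism = X-isAlgebraHomomorphism
      ; N           = MatKₚ.lower Φ.N (∂ (δ t)) Ψ.N
      ; N-nilpotent = MatKₚ.lower-nilpotent Φ.N (∂ (δ t)) Ψ.N Φ.N-nilpotent Ψ.N-nilpotent
      ; ∂Φₜ≈θI+N    = MatKₚ.trans (∂-lower (Φ t) (δ t) (Ψ t))
          (MatKₚ.trans (MatKₚ.lower-cong Φ.∂Φₜ≈θI+N ∂δ≈ Ψ.∂Φₜ≈θI+N)
          (MatKₚ.trans (MatKₚ.sym
              (MatKₚ.lower-+ (θ MatK.· MatK.I) Φ.N (θ MatK.· MatK.0ᴹ) (∂ (δ t)) (θ MatK.· MatK.I) Ψ.N))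
            (MatKₚ.+-cong θI≈ MatKₚ.refl))) }
      where
      -- Padding with θ · 0 lets `lower-+` split the sum into θ times the block form of `I` and the
      -- nilpotent part.
      ∂δ≈ : ∂ (δ t) MatK.≈ (θ MatK.· MatK.0ᴹ) MatK.+ ∂ (δ t)
      ∂δ≈ i j = K.sym (K.trans (K.+-cong (K.zeroʳ θ) K.refl) (K.+-identityˡ _))

      θI≈ : MatKₚ.lower (θ MatK.· MatK.I {d}) (θ MatK.· MatK.0ᴹ) (θ MatK.· MatK.I {e}) MatK.≈ θ MatK.· MatK.I
      θI≈ = MatKₚ.trans (MatKₚ.sym (MatKₚ.lower-map (θ K.*_) (K.zeroʳ θ) (MatK.I {d}) MatK.0ᴹ (MatK.I {e})))
        (λ i j → K.*-cong K.refl (MatKₚ.lower-I {m = d} i j))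

    isShortExact : IsShortExact Ψ X Φ i π
    isShortExact = record
      { Ψ-isTModule = Ψ-isTModule
      ; X-isTModule = X-isTModule
      ; Φ-isTModule = Φ-isTModule
      ; i-morphism  = trans (0⫽I-* d (Ψ t)) (sym (lower-*-0⫽I (Φ t) (δ t) (Ψ t)))
      ; π-morphism  = trans (I∥0-*-lower (Φ t) (δ t) (Ψ t)) (sym (*-I∥0 (Φ t)))
      ; π*i≈0       = trans (I∥0-* d i) (top-⫽ 0ᴹ I)
      ; kernel      = λ Z h h-morphism πh≈0 →
          let top≈0 = trans (sym (I∥0-* d h)) πh≈0 in
          -- With its top block zero, `h` factors through `i` by its bottom block. The δ term in the
          -- lower rows of X_t h multiplies the top block and drops out.
          bottom d h ,
          ( (begin
              bottom d h * (Z ⟨ t ⟩)                  ≈⟨ (λ j → h-morphism (d ↑ʳ j)) ⟩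
              bottom d (X t * h)                      ≈⟨ bottom-lower-* (Φ t) (δ t) (Ψ t) h ⟩
              δ t * top d h + Ψ t * bottom d h
                ≈⟨ +-cong (trans (*-congˡ (δ t) top≈0) (*-zeroʳ (δ t))) refl ⟩
              0ᴹ + Ψ t * bottom d h                   ≈⟨ +-identityˡ (Ψ t * bottom d h) ⟩
              Ψ t * bottom d h                        ∎)
          , (begin
              i * bottom d h                          ≈⟨ 0⫽I-* d (bottom d h) ⟩
              (0ᴹ {d} ⫽ bottom d h)                   ≈⟨ ⫽-cong top≈0 (refl {M = bottom d h}) ⟨
              (top d h ⫽ bottom d h)                  ≈⟨ top⫽bottom d h ⟩
              h                                       ∎) ) ,
          λ {v} (_ , iv≈h) → begin
              bottom d h                              ≈⟨ (λ j → iv≈h (d ↑ʳ j)) ⟨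
              bottom d (i * v)                        ≈⟨ (λ j → 0⫽I-* d v (d ↑ʳ j)) ⟩
              bottom d (0ᴹ {d} ⫽ v)                   ≈⟨ bottom-⫽ (0ᴹ {d}) v ⟩
              v                                       ∎
      ; cokernel    = λ Z h h-morphism hi≈0 →
          let right≈0 = trans (sym (*-0⫽I d h)) hi≈0 in
          -- Dually, the right block of `h` is zero and takes the δ term of h X_t with it.
          left d h ,
          ( (begin
              left d h * Φ t                          ≈⟨ +-identityʳ (left d h * Φ t) ⟨
              left d h * Φ t + 0ᴹ
                ≈⟨ +-cong refl (trans (*-congʳ (δ t) right≈0) (*-zeroˡ (δ t))) ⟨
              left d h * Φ t + right d h * δ t        ≈⟨ left-*-lower (Φ t) (δ t) (Ψ t) h ⟨
              left d (h * X t)                        ≈⟨ (λ j k → h-morphism j (k ↑ˡ e)) ⟩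
              (Z ⟨ t ⟩) * left d h                    ∎)
          , (begin
              left d h * π                            ≈⟨ *-I∥0 (left d h) ⟩
              left d h ∥ 0ᴹ                           ≈⟨ ∥-congˡ (left d h) right≈0 ⟨
              left d h ∥ right d h                    ≈⟨ left∥right d h ⟩
              h                                       ∎) ) ,
          λ {v} (_ , vπ≈h) → begin
              left d h                                ≈⟨ (λ j k → vπ≈h j (k ↑ˡ e)) ⟨
              left d (v * π)                          ≈⟨ (λ j k → *-I∥0 v j (k ↑ˡ e)) ⟩
              left d (v ∥ 0ᴹ {n = e})                 ≈⟨ left-∥ v (0ᴹ {n = e}) ⟩
              v                                       ∎
      }

  -- Pullbacks and pushouts

  module BaseChange {Φ : Family d} {Ψ : Family e} (Φ-isTModule : IsTModule Φ) (Ψ-isTModule : IsTModule Ψ)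
    {δ : A.Carrier → Matrix e d} (δ-isBiderivation : IsBiderivation Φ Ψ δ) where

    open Extension Φ-isTModule Ψ-isTModule δ-isBiderivation using (X; i; π)

    module _ {Ξ : Family r} (Ξ-isTModule : IsTModule Ξ) {g : Matrix d r} (g-morphism : IsMorphism Ξ Φ g) where

      δ·g-isBiderivation : IsBiderivation Ξ Ψ (λ a → δ a * g)
      δ·g-isBiderivation = *-isBiderivation δ-isBiderivation (morphism-commutes Ξ-isTModule Φ-isTModule g-morphism)

      isPullback : IsPullback X Φ Ξ (extension Ξ Ψ (λ a → δ a * g))
                   π g (I {r} ∥ 0ᴹ {r} {e}) (lower g 0ᴹ (I {e}))
      isPullback = record
        { Y-isTModule = Extension.X-isTModule Ξ-isTModule Ψ-isTModule δ·g-isBiderivation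
        ; p₁-morphism = trans (I∥0-*-lower (Ξ t) (δ t * g) (Ψ t)) (sym (*-I∥0 (Ξ t)))
        -- X_t (g ⊕ I) has δ_t g as its lower left block, which dictates the biderivation of the
        -- pullback.
        ; p₂-morphism = begin
            g⊕I * lower (Ξ t) (δ t * g) (Ψ t)
              ≈⟨ lower-* g 0ᴹ I (Ξ t) (δ t * g) (Ψ t) ⟩
            lower (g * Ξ t) (0ᴹ * Ξ t + I * (δ t * g)) (I * Ψ t)
              ≈⟨ lower-cong g-morphism
                  (trans (+-cong (*-zeroˡ (Ξ t)) (*-identityˡ (δ t * g))) (+-identityˡ (δ t * g)))
                  (*-identityˡ (Ψ t)) ⟩
            lower (Φ t * g) (δ t * g) (Ψ t)
              ≈⟨ lower-cong refl
                  (trans (+-cong refl (*-zeroʳ (Ψ t))) (+-identityʳ (δ t * g)))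
                  (*-identityʳ (Ψ t)) ⟨
            lower (Φ t * g) (δ t * g + Ψ t * 0ᴹ) (Ψ t * I)
              ≈⟨ lower-* (Φ t) (δ t) (Ψ t) g 0ᴹ I ⟨
            X t * g⊕I ∎
        ; commutes    = trans (*-I∥0 g) (sym (I∥0-*-lower g 0ᴹ I))
        ; universal   = λ Z h₁ h₂ h₁-morphism h₂-morphism gh₁≈πh₂ →
            let
              gh₁≈top = trans gh₁≈πh₂ (I∥0-* d h₂)
              u = h₁ ⫽ bottom d h₂
            in
            u ,
            ( (begin
                u * (Z ⟨ t ⟩)
                  ≈⟨ ⫽-* h₁ (bottom d h₂) (Z ⟨ t ⟩) ⟩
                (h₁ * (Z ⟨ t ⟩) ⫽ bottom d (h₂ * (Z ⟨ t ⟩)))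
                  ≈⟨ ⫽-cong h₁-morphism (λ j → h₂-morphism (d ↑ʳ j)) ⟩
                (Ξ t * h₁ ⫽ bottom d (X t * h₂))
                  ≈⟨ ⫽-cong (refl {M = Ξ t * h₁}) (bottom-lower-* (Φ t) (δ t) (Ψ t) h₂) ⟩
                (Ξ t * h₁ ⫽ δ t * top d h₂ + Ψ t * bottom d h₂)
                  -- Compatibility of `h₁` and `h₂` makes g h₁ the top block of `h₂`, so the δ term
                  -- of `X` at `h₂` is that of δ·g at `h₁`.
                  ≈⟨ ⫽-cong (refl {M = Ξ t * h₁}) (+-cong (trans (*-assoc (δ t) g h₁) (*-congˡ (δ t) gh₁≈top)) refl) ⟨
                (Ξ t * h₁ ⫽ (δ t * g) * h₁ + Ψ t * bottom d h₂)
                  ≈⟨ lower-*-⫽ (Ξ t) (δ t * g) (Ψ t) h₁ (bottom d h₂) ⟨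
                lower (Ξ t) (δ t * g) (Ψ t) * u ∎)
            , trans (I∥0-* r u) (top-⫽ h₁ (bottom d h₂))
            , (begin
                g⊕I * u                                             ≈⟨ lower-*-⫽ g 0ᴹ I h₁ (bottom d h₂) ⟩
                (g * h₁ ⫽ 0ᴹ * h₁ + I * bottom d h₂)
                  ≈⟨ ⫽-cong gh₁≈top (0*+I* h₁ (bottom d h₂)) ⟩
                (top d h₂ ⫽ bottom d h₂)                            ≈⟨ top⫽bottom d h₂ ⟩
                h₂                                                  ∎) ) ,
            -- The top block of `v` is seen through the projection to Ξ, the bottom one through the
            -- identity block of g ⊕ I.
            λ {v} (_ , p₁v≈h₁ , p₂v≈h₂) → begin
              (h₁ ⫽ bottom d h₂)              ≈⟨ ⫽-cong p₁v≈h₁ (λ j → p₂v≈h₂ (d ↑ʳ j)) ⟨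
              ((I ∥ 0ᴹ) * v ⫽ bottom d (g⊕I * v))
                ≈⟨ ⫽-cong (I∥0-* r v) (trans (bottom-lower-* g 0ᴹ I v) (0*+I* (top r v) (bottom r v))) ⟩
              (top r v ⫽ bottom r v)          ≈⟨ top⫽bottom r v ⟩
              v                               ∎
        }
        where
        g⊕I = lower g 0ᴹ (I {e})

        0*+I* : ∀ {z} (M : Matrix r z) (N : Matrix e z) → 0ᴹ * M + I * N ≈ N
        0*+I* M N = trans (+-cong (*-zeroˡ M) (*-identityˡ N)) (+-identityˡ N)

    module _ {Ξ : Family r} (Ξ-isTModule : IsTModule Ξ) {f : Matrix r e} (f-morphism : IsMorphism Ψ Ξ f) where

      f·δ-isBiderivation : IsBiderivation Φ Ξ (λ a → f * δ a)
      f·δ-isBiderivation = isBiderivation-* δ-isBiderivation (morphism-commutes Ψ-isTModule Ξ-isTModule f-morphism)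

      isPushout : IsPushout Ψ X Ξ (extension Φ Ξ (λ a → f * δ a))
                  i f (0ᴹ {d} {r} ⫽ I {r}) (lower (I {d}) 0ᴹ f)
      isPushout = record
        { Y-isTModule = Extension.X-isTModule Φ-isTModule Ξ-isTModule f·δ-isBiderivation
        ; q₁-morphism = trans (0⫽I-* d (Ξ t)) (sym (lower-*-0⫽I (Φ t) (f * δ t) (Ξ t)))
        -- Dually, f δ_t is the lower left block of (I ⊕ f) X_t.
        ; q₂-morphism = begin
            I⊕f * X t
              ≈⟨ lower-* I 0ᴹ f (Φ t) (δ t) (Ψ t) ⟩
            lower (I * Φ t) (0ᴹ * Φ t + f * δ t) (f * Ψ t)
              ≈⟨ lower-cong (*-identityˡ (Φ t))
                  (trans (+-cong (*-zeroˡ (Φ t)) refl) (+-identityˡ (f * δ t))) f-morphism ⟩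
            lower (Φ t) (f * δ t) (Ξ t * f)
              ≈⟨ lower-cong (*-identityʳ (Φ t)) (*I+*0 (f * δ t) (Ξ t)) refl ⟨
            lower (Φ t * I) ((f * δ t) * I + Ξ t * 0ᴹ) (Ξ t * f)
              ≈⟨ lower-* (Φ t) (f * δ t) (Ξ t) I 0ᴹ f ⟨
            lower (Φ t) (f * δ t) (Ξ t) * I⊕f ∎
        ; commutes    = trans (0⫽I-* d f) (sym (lower-*-0⫽I I 0ᴹ f))
        ; universal   = λ Z h₁ h₂ h₁-morphism h₂-morphism h₁f≈h₂i →
            let
              h₁f≈right = trans h₁f≈h₂i (*-0⫽I d h₂)
              u = left d h₂ ∥ h₁
            in
            u ,
            ( (begin
                u * lower (Φ t) (f * δ t) (Ξ t)
                  ≈⟨ ∥-*-lower (left d h₂) h₁ (Φ t) (f * δ t) (Ξ t) ⟩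
                left d h₂ * Φ t + h₁ * (f * δ t) ∥ h₁ * Ξ t
                  -- Compatibility makes h₁ f the right block of `h₂`, which turns the f·δ term into
                  -- the δ term of `h₂ * X t`.
                  ≈⟨ ∥-cong (+-cong refl (trans (sym (*-assoc h₁ f (δ t))) (*-congʳ (δ t) h₁f≈right))) h₁-morphism ⟩
                left d h₂ * Φ t + right d h₂ * δ t ∥ (Z ⟨ t ⟩) * h₁
                  ≈⟨ ∥-cong (left-*-lower (Φ t) (δ t) (Ψ t) h₂) (refl {M = (Z ⟨ t ⟩) * h₁}) ⟨
                left d (h₂ * X t) ∥ (Z ⟨ t ⟩) * h₁
                  ≈⟨ ∥-cong (λ j k → h₂-morphism j (k ↑ˡ e)) (refl {M = (Z ⟨ t ⟩) * h₁}) ⟩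
                left d ((Z ⟨ t ⟩) * h₂) ∥ (Z ⟨ t ⟩) * h₁
                  ≈⟨ *-∥ (Z ⟨ t ⟩) (left d h₂) h₁ ⟨
                (Z ⟨ t ⟩) * u ∎)
            , trans (*-0⫽I d u) (right-∥ (left d h₂) h₁)
            , (begin
                u * I⊕f                                   ≈⟨ ∥-*-lower (left d h₂) h₁ I 0ᴹ f ⟩
                left d h₂ * I + h₁ * 0ᴹ ∥ h₁ * f          ≈⟨ ∥-cong (*I+*0 (left d h₂) h₁) h₁f≈right ⟩
                left d h₂ ∥ right d h₂                    ≈⟨ left∥right d h₂ ⟩
                h₂                                        ∎) ) ,
            λ {v} (_ , vq₁≈h₁ , vq₂≈h₂) → begin
              left d h₂ ∥ h₁                              ≈⟨ ∥-cong (λ j k → vq₂≈h₂ j (k ↑ˡ e)) vq₁≈h₁ ⟨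
              left d (v * I⊕f) ∥ v * (0ᴹ {d} ⫽ I)
                ≈⟨ ∥-cong (trans (left-*-lower I 0ᴹ f v) (*I+*0 (left d v) (right d v))) (*-0⫽I d v) ⟩
              left d v ∥ right d v                        ≈⟨ left∥right d v ⟩
              v                                           ∎
        }
        where
        I⊕f = lower (I {d}) 0ᴹ f

        *I+*0 : ∀ {z} (M : Matrix z d) (N : Matrix z r) → M * I + N * 0ᴹ ≈ M
        *I+*0 M N = trans (+-cong (*-identityʳ M) (*-zeroʳ N)) (+-identityʳ M)

-- The closing identities of the two parts complete the commuting squares to morphisms of short
-- exact sequences, with the identity on Ψ for the pullback and on Φ for the pushout. This expresses
-- that `Y` is the extension obtained from `X` by base change.
theorem10p1 :
  {c₁ ℓ₁ a₁ c₂ ℓ₂ a₂ : Level} (B : BaseData c₁ ℓ₁ a₁ c₂ ℓ₂ a₂) →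
  let open TModules B in
  (d e : ℕ) (Φ : TModule d) (Ψ : TModule e)
  (δ : A.Carrier → Matrix e d) → IsBiderivation (Φ ⟨_⟩) (Ψ ⟨_⟩) δ →
  let X = extension (Φ ⟨_⟩) (Ψ ⟨_⟩) δ
      i = 0ᴹ {d} {e} ⫽ I {e}
      π = I {d} ∥ 0ᴹ {d} {e}
  in
  IsShortExact (Ψ ⟨_⟩) X (Φ ⟨_⟩) i π
  ×
  ((r : ℕ) (Ξ : TModule r) (g : Matrix d r) → IsMorphism (Ξ ⟨_⟩) (Φ ⟨_⟩) g →
    let δ·g = λ a → δ a * g
        Y   = extension (Ξ ⟨_⟩) (Ψ ⟨_⟩) δ·g
        iY  = 0ᴹ {r} {e} ⫽ I {e}
        πY  = I {r} ∥ 0ᴹ {r} {e}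
        g⊕I = g ∥ 0ᴹ {d} {e} ⫽ 0ᴹ {e} {r} ∥ I {e}
    in
    IsBiderivation (Ξ ⟨_⟩) (Ψ ⟨_⟩) δ·g
    × IsPullback X (Φ ⟨_⟩) (Ξ ⟨_⟩) Y π g πY g⊕I
    × IsShortExact (Ψ ⟨_⟩) Y (Ξ ⟨_⟩) iY πY
    × g⊕I * iY ≈ i)
  ×
  ((r : ℕ) (Ξ : TModule r) (f : Matrix r e) → IsMorphism (Ψ ⟨_⟩) (Ξ ⟨_⟩) f →
    let f·δ = λ a → f * δ a
        Y   = extension (Φ ⟨_⟩) (Ξ ⟨_⟩) f·δ
        iY  = 0ᴹ {d} {r} ⫽ I {r}
        πY  = I {d} ∥ 0ᴹ {d} {r}
        I⊕f = I {d} ∥ 0ᴹ {d} {e} ⫽ 0ᴹ {r} {d} ∥ f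
    in
    IsBiderivation (Φ ⟨_⟩) (Ξ ⟨_⟩) f·δ
    × IsPushout (Ψ ⟨_⟩) X (Ξ ⟨_⟩) Y i f iY I⊕f
    × IsShortExact (Ξ ⟨_⟩) Y (Φ ⟨_⟩) iY πY
    × πY * I⊕f ≈ π)
theorem10p1 B d e Φ Ψ δ δ-isBiderivation =
    Extension.isShortExact (isTModule Φ) (isTModule Ψ) δ-isBiderivation
  , (λ r Ξ g g-morphism →
      δ·g-isBiderivation (isTModule Ξ) g-morphism
    , isPullback (isTModule Ξ) g-morphism
    , Extension.isShortExact (isTModule Ξ) (isTModule Ψ) (δ·g-isBiderivation (isTModule Ξ) g-morphism)
    , lower-*-0⫽I g 0ᴹ I)
  , (λ r Ξ f f-morphism →
      f·δ-isBiderivation (isTModule Ξ) f-morphism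
    , isPushout (isTModule Ξ) f-morphism
    , Extension.isShortExact (isTModule Φ) (isTModule Ξ) (f·δ-isBiderivation (isTModule Ξ) f-morphism)
    , I∥0-*-lower I 0ᴹ f)
  where
  open TModules B
  open TModuleProperties B
  open MatrixProperties K⟨τ⟩.rawRing K⟨τ⟩-Properties.skew-isRing using (lower-*-0⫽I; I∥0-*-lower)
  open BaseChange (isTModule Φ) (isTModule Ψ) δ-isBiderivation
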